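{- Let $k,n\in\mathbb{N}$ and $m\in\mathbb{N}_0$ be such that $m\le k<n$. Then $$\mathcal{E}_m(1,\zeta_n,\ldots,\zeta_n^{k-1})=\begin{cases}\displaystyle(-1)^m\zeta_n^{mk}\prod_{j=1}^{n-k-1}\frac{1-\zeta_n^{m+j}}{1-\zeta_n^{j}} & \text{if } k\le n-2,\\[2mm] (-1)^m\zeta_n^{ -m} & \text{if } k=n-1.\end{cases}$$
   Context: $\mathbb{N}=\{1,2,\ldots\}$, $\mathbb{N}_0=\mathbb{N}\cup\{0\}$, $\zeta_n:=e^{2\pi i/n}$. For complex numbers $z_1,\ldots,z_r$, the elementary symmetric polynomials are $\mathcal{E}_0(z_1,\ldots,z_r):=1$, $\mathcal{E}_m(z_1,\ldots,z_r):=\sum_{1\le j_1<\cdots<j_m\le r}z_{j_1}\cdots z_{j_m}$ for $1\le m\le r$, and $\mathcal{E}_m(z_1,\ldots,z_r):=0$ for $m>r$. -}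

module Defs where

open import Algebra.Bundles using (CommutativeRing; RawRing)
open import Algebra.Apartness.Bundles using (HeytingField)
import Algebra.Definitions
import Algebra.Definitions.RawSemiring
import Algebra.Properties.Ring
import Algebra.Properties.AbelianGroup
import Algebra.Properties.Semiring.Mult
import Algebra.Apartness.Properties.HeytingCommutativeRing
open import Algebra.Solver.Ring.AlmostCommutativeRing
  using (fromCommutativeRing; _-Raw-AlmostCommutative⟶_)
import Algebra.Solver.Ring
open import Data.List.Base using (List; []; _∷_; _++_; map; foldr)
open import Data.Maybe.Base using (Maybe; just; nothing)
open import Data.Nat.Base as ℕ using (ℕ; zero; suc; NonZero; _!)
import Data.Nat.Properties as ℕ
open import Data.Nat.Solver using (module +-*-Solver)
open import Data.Product.Base using (∃-syntax; _×_; _,_; proj₁; proj₂)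
open import Data.Sum.Base using (_⊎_; inj₁; inj₂)
open import Function.Bundles using (_⇔_; module Equivalence)
open import Level using (Level; _⊔_)
open import Relation.Binary.Core using (Rel)
open import Relation.Binary.Structures using (IsStrictPartialOrder)
open import Relation.Binary.PropositionalEquality as ≡ using (_≡_)
open import Relation.Nullary.Decidable using (yes; no)

-- The real numbers, axiomatically: an ordered Heyting field that is Archimedean
-- and Cauchy complete.  Classically these axioms determine ℝ up to isomorphism;
-- constructively they are satisfied by Bishop's reals.

record RealField (c ℓ₁ ℓ₂ : Level) : Set (Level.suc (c ⊔ ℓ₁ ⊔ ℓ₂)) where
  infix 4 _<_ _⟶_
  field
    heytingField : HeytingField c ℓ₁ ℓ₂

  open HeytingField heytingField public

  commutativeRing : CommutativeRing c ℓ₁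
  commutativeRing = record { isCommutativeRing = isCommutativeRing }

  open Algebra.Properties.Semiring.Mult (CommutativeRing.semiring commutativeRing)
    using () renaming (_×_ to _·_)

  fromℕ : ℕ → Carrier
  fromℕ n = n · 1#

  field
    _<_                  : Rel Carrier ℓ₂
    isStrictPartialOrder : IsStrictPartialOrder _≈_ _<_
    #⇔<⊎>                : ∀ {x y} → x # y ⇔ (x < y ⊎ y < x)
    +-monoˡ-<            : ∀ {x y} z → x < y → x + z < y + z
    *-pos                : ∀ {x y} → 0# < x → 0# < y → 0# < x * y
    archimedean          : ∀ x → ∃[ n ] x < fromℕ n

  _⟶_ : (ℕ → Carrier) → Carrier → Set (c ⊔ ℓ₂)
  s ⟶ l = ∀ ε → 0# < ε → ∃[ N ] ∀ p → N ℕ.≤ p → s p - l < ε × l - s p < ε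

  -- No absolute value is needed: p and q may be interchanged.
  Cauchy : (ℕ → Carrier) → Set (c ⊔ ℓ₂)
  Cauchy s = ∀ ε → 0# < ε → ∃[ N ] ∀ p q → N ℕ.≤ p → N ℕ.≤ q → s p - s q < ε

  field
    complete : ∀ s → Cauchy s → ∃[ l ] s ⟶ l

-- The library's ring solver for an arbitrary commutative ring; the pair (a , b)
-- stands for the integer coefficient a - b.

module IntegerCoefficients {c ℓ} (R : CommutativeRing c ℓ) where
  open CommutativeRing R
  open Algebra.Properties.Ring ring
  open Algebra.Properties.AbelianGroup +-abelianGroup using (⁻¹-∙-comm)
  open Algebra.Properties.Semiring.Mult semiring
    using (×-homo-+; ×1-homo-*) renaming (_×_ to _·_)
  open import Relation.Binary.Reasoning.Setoid setoid

  private
    reduce : ℕ × ℕ → ℕ × ℕ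
    reduce (suc a , suc b) = reduce (a , b)
    reduce p               = p

    coeffs : RawRing _ _
    coeffs = record
      { Carrier = ℕ × ℕ
      ; _≈_     = _≡_
      ; _+_     = λ (a , b) (c , d) → reduce (a ℕ.+ c , b ℕ.+ d)
      ; _*_     = λ (a , b) (c , d) → reduce (a ℕ.* c ℕ.+ b ℕ.* d , a ℕ.* d ℕ.+ b ℕ.* c)
      ; -_      = λ (a , b) → b , a
      ; 0#      = 0 , 0
      ; 1#      = 1 , 0
      }

    ⟦_⟧ᶜ : ℕ × ℕ → Carrier
    ⟦ a , b ⟧ᶜ = a · 1# - b · 1#

    exchange : ∀ w x y z → (w + x) + (y + z) ≈ (w + y) + (x + z)
    exchange w x y z = begin
      (w + x) + (y + z) ≈⟨ +-assoc _ _ _ ⟩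
      w + (x + (y + z)) ≈⟨ +-congˡ (sym (+-assoc _ _ _)) ⟩
      w + ((x + y) + z) ≈⟨ +-congˡ (+-congʳ (+-comm _ _)) ⟩
      w + ((y + x) + z) ≈⟨ +-congˡ (+-assoc _ _ _) ⟩
      w + (y + (x + z)) ≈⟨ sym (+-assoc _ _ _) ⟩
      (w + y) + (x + z) ∎

    reduce-correct : ∀ a b → ⟦ reduce (a , b) ⟧ᶜ ≈ a · 1# - b · 1#
    reduce-correct zero    b       = refl
    reduce-correct (suc a) zero    = refl
    reduce-correct (suc a) (suc b) = begin
      ⟦ reduce (a , b) ⟧ᶜ                 ≈⟨ reduce-correct a b ⟩
      a · 1# - b · 1#                     ≈⟨ sym (+-identityˡ _) ⟩
      0# + (a · 1# - b · 1#)              ≈⟨ +-congʳ (sym (-‿inverseʳ 1#)) ⟩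
      (1# - 1#) + (a · 1# - b · 1#)       ≈⟨ exchange _ _ _ _ ⟩
      (1# + a · 1#) + (- 1# - b · 1#)     ≈⟨ +-congˡ (⁻¹-∙-comm _ _) ⟩
      (1# + a · 1#) - (1# + b · 1#)       ∎

    +-homo : ∀ p q → ⟦ RawRing._+_ coeffs p q ⟧ᶜ ≈ ⟦ p ⟧ᶜ + ⟦ q ⟧ᶜ
    +-homo (a , b) (c , d) = begin
      ⟦ reduce (a ℕ.+ c , b ℕ.+ d) ⟧ᶜ ≈⟨ reduce-correct (a ℕ.+ c) (b ℕ.+ d) ⟩
      (a ℕ.+ c) · 1# - (b ℕ.+ d) · 1#
        ≈⟨ +-cong (×-homo-+ 1# a c) (-‿cong (×-homo-+ 1# b d)) ⟩
      (a · 1# + c · 1#) - (b · 1# + d · 1#) ≈⟨ +-congˡ (sym (⁻¹-∙-comm _ _)) ⟩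
      (a · 1# + c · 1#) + (- (b · 1#) - d · 1#) ≈⟨ exchange _ _ _ _ ⟩
      (a · 1# - b · 1#) + (c · 1# - d · 1#) ∎

    *-homo : ∀ p q → ⟦ RawRing._*_ coeffs p q ⟧ᶜ ≈ ⟦ p ⟧ᶜ * ⟦ q ⟧ᶜ
    *-homo (a , b) (c , d) = begin
      ⟦ reduce (a ℕ.* c ℕ.+ b ℕ.* d , a ℕ.* d ℕ.+ b ℕ.* c) ⟧ᶜ
        ≈⟨ reduce-correct (a ℕ.* c ℕ.+ b ℕ.* d) (a ℕ.* d ℕ.+ b ℕ.* c) ⟩
      (a ℕ.* c ℕ.+ b ℕ.* d) · 1# - (a ℕ.* d ℕ.+ b ℕ.* c) · 1#
        ≈⟨ +-cong (two a c b d) (-‿cong (trans (two a d b c) (+-comm _ _))) ⟩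
      (A * C + B * D) - (B * C + A * D)
        ≈⟨ +-congˡ (sym (⁻¹-∙-comm _ _)) ⟩
      (A * C + B * D) + (- (B * C) - A * D)
        ≈⟨ exchange _ _ _ _ ⟩
      (A * C - B * C) + (B * D - A * D)
        ≈⟨ +-cong (sym ([y-z]x≈yx-zx C A B)) (begin
             B * D - A * D     ≈⟨ +-comm _ _ ⟩
             - (A * D) + B * D ≈⟨ +-congˡ (sym (-‿involutive _)) ⟩
             - (A * D) - - (B * D) ≈⟨ ⁻¹-∙-comm _ _ ⟩
             - (A * D - B * D) ≈⟨ -‿cong (sym ([y-z]x≈yx-zx D A B)) ⟩
             - ((A - B) * D)   ≈⟨ -‿distribʳ-* _ _ ⟩
             (A - B) * - D     ∎) ⟩
      (A - B) * C + (A - B) * - D ≈⟨ sym (distribˡ _ _ _) ⟩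
      (A - B) * (C - D) ∎
      where
      A B C D : Carrier
      A = a · 1# ; B = b · 1# ; C = c · 1# ; D = d · 1#
      two : ∀ a c b d → (a ℕ.* c ℕ.+ b ℕ.* d) · 1#
                      ≈ a · 1# * c · 1# + b · 1# * d · 1#
      two a c b d = trans (×-homo-+ 1# (a ℕ.* c) (b ℕ.* d))
                          (+-cong (×1-homo-* a c) (×1-homo-* b d))

    -‿homo : ∀ p → ⟦ RawRing.-_ coeffs p ⟧ᶜ ≈ - ⟦ p ⟧ᶜ
    -‿homo (a , b) = begin
      b · 1# - a · 1#       ≈⟨ +-comm _ _ ⟩
      - (a · 1#) + b · 1#   ≈⟨ +-congˡ (sym (-‿involutive _)) ⟩
      - (a · 1#) - - (b · 1#) ≈⟨ ⁻¹-∙-comm _ _ ⟩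
      - (a · 1# - b · 1#)   ∎

    morphism : coeffs -Raw-AlmostCommutative⟶ fromCommutativeRing R
    morphism = record
      { ⟦_⟧    = ⟦_⟧ᶜ
      ; +-homo = +-homo
      ; *-homo = *-homo
      ; -‿homo = -‿homo
      ; 0-homo = -‿inverseʳ 0#
      ; 1-homo = trans (+-cong (+-identityʳ 1#) -0#≈0#) (+-identityʳ 1#)
      }

    _≟ᶜ_ : ∀ p q → Maybe (⟦ p ⟧ᶜ ≈ ⟦ q ⟧ᶜ)
    (a , b) ≟ᶜ (c , d) with a ℕ.≟ c | b ℕ.≟ d
    ... | yes ≡.refl | yes ≡.refl = just refl
    ... | _          | _          = nothing

  open Algebra.Solver.Ring coeffs (fromCommutativeRing R) morphism _≟ᶜ_ public

module OrderProperties {c ℓ₁ ℓ₂} (R : RealField c ℓ₁ ℓ₂) where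
  open RealField R
  open CommutativeRing commutativeRing using (semiring)
  open Algebra.Apartness.Properties.HeytingCommutativeRing heytingCommutativeRing
    using (1#0; invertibleˡ⇒#; x-0≈x)
  open Algebra.Properties.Semiring.Mult semiring using (×-homo-+; ×1-homo-*)
  open IsStrictPartialOrder isStrictPartialOrder public
    using () renaming (irrefl to <-irrefl; trans to <-trans; <-respʳ-≈ to <-respʳ; <-respˡ-≈ to <-respˡ)
  open IntegerCoefficients commutativeRing using (solve; con; _:+_; _:*_; _:-_; :-_; _:=_)
  open import Relation.Binary.Reasoning.Setoid setoid

  x<y⇒0<y-x : ∀ {x y} → x < y → 0# < y - x
  x<y⇒0<y-x {x} x<y = <-respˡ (-‿inverseʳ x) (+-monoˡ-< (- x) x<y)

  0<y-x⇒x<y : ∀ {x y} → 0# < y - x → x < y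
  0<y-x⇒x<y {x} {y} p = <-respˡ (+-identityˡ x)
    (<-respʳ (solve 2 (λ x y → (y :- x) :+ x := y) refl x y) (+-monoˡ-< x p))

  +-mono-< : ∀ {w x y z} → w < x → y < z → w + y < x + z
  +-mono-< {w} {x} {y} {z} w<x y<z = <-trans (+-monoˡ-< y w<x)
    (<-respˡ (+-comm y x) (<-respʳ (+-comm z x) (+-monoˡ-< x y<z)))

  +-pos : ∀ {x y} → 0# < x → 0# < y → 0# < x + y
  +-pos p q = <-respˡ (+-identityˡ 0#) (+-mono-< p q)

  *-monoˡ-< : ∀ {x y z} → 0# < z → x < y → z * x < z * y
  *-monoˡ-< {x} {y} {z} 0<z x<y = 0<y-x⇒x<y
    (<-respʳ (solve 3 (λ x y z → z :* (y :- x) := z :* y :- z :* x) refl x y z)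
             (*-pos 0<z (x<y⇒0<y-x x<y)))

  cotransitive : ∀ {x y} → x < y → ∀ z → x < z ⊎ z < y
  cotransitive x<y z with #-cotrans (Equivalence.from #⇔<⊎> (inj₁ x<y)) z
  ... | inj₁ x#z with Equivalence.to #⇔<⊎> x#z
  ...   | inj₁ x<z = inj₁ x<z
  ...   | inj₂ z<x = inj₂ (<-trans z<x x<y)
  cotransitive x<y z | inj₂ z#y with Equivalence.to #⇔<⊎> z#y
  ...   | inj₁ z<y = inj₂ z<y
  ...   | inj₂ y<z = inj₁ (<-trans x<y y<z)

  0<x+x⇒0<x : ∀ {x} → 0# < x + x → 0# < x
  0<x+x⇒0<x {x} p with cotransitive p x
  ... | inj₁ 0<x = 0<x
  ... | inj₂ q   = <-respʳ (solve 1 (λ x → (x :+ x) :- x := x) refl x) (x<y⇒0<y-x q)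

  0<1 : 0# < 1#
  0<1 with Equivalence.to #⇔<⊎> 1#0
  ... | inj₂ 0<1 = 0<1
  ... | inj₁ 1<0 = <-respʳ
    (trans (solve 1 (λ x → (:- x) :* (:- x) := x :* x) refl 1#) (*-identityˡ 1#))
    (*-pos 0<-1 0<-1)
    where
    0<-1 : 0# < - 1#
    0<-1 = <-respʳ (+-identityˡ (- 1#)) (x<y⇒0<y-x 1<0)

  fromℕ-homo-+ : ∀ m n → fromℕ (m ℕ.+ n) ≈ fromℕ m + fromℕ n
  fromℕ-homo-+ = ×-homo-+ 1#

  fromℕ-homo-* : ∀ m n → fromℕ (m ℕ.* n) ≈ fromℕ m * fromℕ n
  fromℕ-homo-* = ×1-homo-*

  fromℕ-pos : ∀ n → 0# < fromℕ (suc n)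
  fromℕ-pos zero    = <-respʳ (sym (+-identityʳ 1#)) 0<1
  fromℕ-pos (suc n) = +-pos 0<1 (fromℕ-pos n)

  fromℕ-mono-< : ∀ {m n} → m ℕ.< n → fromℕ m < fromℕ n
  fromℕ-mono-< {zero}  {suc n} _             = fromℕ-pos n
  fromℕ-mono-< {suc m} {suc n} (ℕ.s≤s m<n) =
    <-respˡ (+-comm _ _) (<-respʳ (+-comm _ _) (+-monoˡ-< 1# (fromℕ-mono-< m<n)))

  fromℕ#0 : ∀ n → .{{NonZero n}} → fromℕ n # 0#
  fromℕ#0 (suc n) = Equivalence.from #⇔<⊎> (inj₂ (fromℕ-pos n))

  recip : ∀ n → .{{NonZero n}} → Carrier
  recip n = proj₁ (#⇒invertible (fromℕ#0 n))

  recip-inverse : ∀ n → .{{_ : NonZero n}} → fromℕ n * recip n ≈ 1#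
  recip-inverse n = trans (*-congʳ (sym (x-0≈x (fromℕ n))))
                          (proj₂ (proj₂ (#⇒invertible (fromℕ#0 n))))

  recip-pos : ∀ n → .{{_ : NonZero n}} → 0# < recip n
  recip-pos n@(suc n-1) with Equivalence.to #⇔<⊎> r#0
    where
    r#0 : recip n # 0#
    r#0 = invertibleˡ⇒# (fromℕ n , trans (*-congˡ (x-0≈x (recip n))) (recip-inverse n))
  ... | inj₂ 0<r = 0<r
  ... | inj₁ r<0 = <-respʳ eq (*-pos (*-pos (fromℕ-pos n-1) 0<-r) 0<-r)
    where
    0<-r : 0# < - recip n
    0<-r = <-respʳ (+-identityˡ _) (x<y⇒0<y-x r<0)
    eq : (fromℕ n * - recip n) * - recip n ≈ recip n
    eq = trans (solve 2 (λ x r → (x :* (:- r)) :* (:- r) := (x :* r) :* r) refl (fromℕ n) (recip n))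
               (trans (*-congʳ (recip-inverse n)) (*-identityˡ _))

  infixl 7 _÷_
  _÷_ : ℕ → ∀ b → .{{NonZero b}} → Carrier
  a ÷ b = fromℕ a * recip b

  ÷-mono-< : ∀ {a c} b d → .{{_ : NonZero b}} → .{{_ : NonZero d}} →
             a ℕ.* d ℕ.< c ℕ.* b → a ÷ b < c ÷ d
  ÷-mono-< {a} {c} b d ad<cb =
    <-respˡ lhs (<-respʳ rhs
      (*-monoˡ-< (*-pos (recip-pos b) (recip-pos d)) (fromℕ-mono-< ad<cb)))
    where
    lhs : (recip b * recip d) * fromℕ (a ℕ.* d) ≈ a ÷ b
    lhs = begin
      (recip b * recip d) * fromℕ (a ℕ.* d) ≈⟨ *-congˡ (fromℕ-homo-* a d) ⟩
      (recip b * recip d) * (fromℕ a * fromℕ d)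
        ≈⟨ solve 4 (λ r s x y → (r :* s) :* (x :* y) := (x :* r) :* (y :* s)) refl _ _ _ _ ⟩
      (a ÷ b) * (fromℕ d * recip d)         ≈⟨ *-congˡ (recip-inverse d) ⟩
      (a ÷ b) * 1#                          ≈⟨ *-identityʳ _ ⟩
      a ÷ b                                 ∎
    rhs : (recip b * recip d) * fromℕ (c ℕ.* b) ≈ c ÷ d
    rhs = begin
      (recip b * recip d) * fromℕ (c ℕ.* b) ≈⟨ *-congˡ (fromℕ-homo-* c b) ⟩
      (recip b * recip d) * (fromℕ c * fromℕ b)
        ≈⟨ solve 4 (λ r s x y → (r :* s) :* (x :* y) := (x :* s) :* (y :* r)) refl _ _ _ _ ⟩
      (c ÷ d) * (fromℕ b * recip b)         ≈⟨ *-congˡ (recip-inverse b) ⟩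
      (c ÷ d) * 1#                          ≈⟨ *-identityʳ _ ⟩
      c ÷ d                                 ∎

  ÷-halves : ∀ a b → .{{_ : NonZero b}} → .{{_ : NonZero (2 ℕ.* b)}} →
             a ÷ (2 ℕ.* b) + a ÷ (2 ℕ.* b) ≈ a ÷ b
  ÷-halves a b = begin
    x * s + x * s             ≈⟨ sym (*-identityʳ _) ⟩
    (x * s + x * s) * 1#      ≈⟨ *-congˡ (sym (recip-inverse b)) ⟩
    (x * s + x * s) * (y * r)
      ≈⟨ solve 4 (λ x y r s → (x :* s :+ x :* s) :* (y :* r)
                           := (x :* r) :* ((y :+ y) :* s)) refl x y r s ⟩
    (x * r) * ((y + y) * s)   ≈⟨ *-congˡ (*-congʳ (sym 2y)) ⟩
    (x * r) * (fromℕ (2 ℕ.* b) * s) ≈⟨ *-congˡ (recip-inverse (2 ℕ.* b)) ⟩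
    (x * r) * 1#              ≈⟨ *-identityʳ _ ⟩
    x * r                     ∎
    where
    x y r s : Carrier
    x = fromℕ a ; y = fromℕ b ; r = recip b ; s = recip (2 ℕ.* b)
    2y : fromℕ (2 ℕ.* b) ≈ y + y
    2y = trans (fromℕ-homo-+ b (b ℕ.+ 0))
               (+-congˡ (trans (fromℕ-homo-+ b 0) (+-identityʳ y)))

  n<2^n : ∀ n → n ℕ.< 2 ℕ.^ n
  n<2^n zero    = ℕ.s≤s ℕ.z≤n
  n<2^n (suc n) = ℕ.+-mono-≤ (ℕ.≤-trans (ℕ.s≤s ℕ.z≤n) (n<2^n n))
                    (ℕ.≤-trans (n<2^n n) (ℕ.m≤m+n (2 ℕ.^ n) 0))

  infixl 7 _÷2^_
  _÷2^_ : ℕ → ℕ → Carrier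
  a ÷2^ j = _÷_ a (2 ℕ.^ j) {{ℕ.m^n≢0 2 j}}

  ÷2^-halves : ∀ a j → a ÷2^ suc j + a ÷2^ suc j ≈ a ÷2^ j
  ÷2^-halves a j = ÷-halves a (2 ℕ.^ j) {{ℕ.m^n≢0 2 j}} {{ℕ.m^n≢0 2 (suc j)}}

  ÷2^-small : ∀ a {ε} → 0# < ε → ∃[ j ] a ÷2^ j < ε
  ÷2^-small a {ε} 0<ε
    with #⇒invertible (Equivalence.from #⇔<⊎> (inj₂ 0<ε))
  ... | ε⁻¹ , _ , ε-0*ε⁻¹≈1 with archimedean (ε⁻¹ * fromℕ a)
  ...   | n , a/ε<n = n , <-respˡ (*-comm _ _) (<-respʳ eq (*-monoˡ-< (recip-pos (2 ℕ.^ n) {{ℕ.m^n≢0 2 n}}) a<ε2ⁿ))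
    where
    instance
      2ⁿ≢0 : NonZero (2 ℕ.^ n)
      2ⁿ≢0 = ℕ.m^n≢0 2 n
    a<ε2ⁿ : fromℕ a < ε * fromℕ (2 ℕ.^ n)
    a<ε2ⁿ = <-respˡ
      (trans (sym (*-assoc _ _ _))
        (trans (*-congʳ (trans (*-congʳ (sym (x-0≈x ε))) ε-0*ε⁻¹≈1)) (*-identityˡ _)))
      (*-monoˡ-< 0<ε (<-trans a/ε<n (fromℕ-mono-< (n<2^n n))))
    eq : recip (2 ℕ.^ n) * (ε * fromℕ (2 ℕ.^ n)) ≈ ε
    eq = trans (solve 3 (λ r e x → r :* (e :* x) := e :* (x :* r)) refl _ _ _)
           (trans (*-congˡ (recip-inverse (2 ℕ.^ n))) (*-identityʳ ε))

  -- x ◁ b says that ∣ x ∣ < b.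
  infix 4 _◁_
  _◁_ : Carrier → Carrier → Set ℓ₂
  x ◁ b = x < b × - x < b

  ◁-resp : ∀ {x y a b} → x ≈ y → a ≈ b → x ◁ a → y ◁ b
  ◁-resp x≈y a≈b (p , q) =
    <-respˡ x≈y (<-respʳ a≈b p) , <-respˡ (-‿cong x≈y) (<-respʳ a≈b q)

  ◁-weaken : ∀ {x a b} → a < b → x ◁ a → x ◁ b
  ◁-weaken a<b (p , q) = <-trans p a<b , <-trans q a<b

  0◁ : ∀ {b} → 0# < b → 0# ◁ b
  0◁ 0<b = 0<b , <-respˡ (sym (trans (sym (+-identityˡ _)) (-‿inverseʳ 0#))) 0<b

  ◁-neg : ∀ {x b} → x ◁ b → - x ◁ b
  ◁-neg {x} (p , q) = q , <-respˡ (solve 1 (λ x → x := :- (:- x)) refl x) p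

  ◁-+ : ∀ {x y a b} → x ◁ a → y ◁ b → x + y ◁ a + b
  ◁-+ {x} {y} (p , q) (p′ , q′) = +-mono-< p p′ ,
    <-respˡ (solve 2 (λ x y → (:- x) :+ (:- y) := :- (x :+ y)) refl x y) (+-mono-< q q′)

  ◁-scale : ∀ {x a} r → 0# < r → x ◁ a → r * x ◁ r * a
  ◁-scale {x} r 0<r (p , q) = *-monoˡ-< 0<r p ,
    <-respˡ (solve 2 (λ r x → r :* (:- x) := :- (r :* x)) refl r x) (*-monoˡ-< 0<r q)

  ◁-* : ∀ {x y a b} → x ◁ a → y ◁ b → x * y ◁ a * b
  ◁-* {x} {y} {a} {b} (p , q) (p′ , q′) = upper p q p′ q′ ,
    <-respˡ (solve 2 (λ x y → (:- x) :* y := :- (x :* y)) refl x y)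
      (upper q (<-respˡ (solve 1 (λ x → x := :- (:- x)) refl x) p) p′ q′)
    where
    upper : ∀ {x y a b} → x < a → - x < a → y < b → - y < b → x * y < a * b
    upper {x} {y} {a} {b} p q p′ q′ = 0<y-x⇒x<y (0<x+x⇒0<x (<-respʳ
      (solve 4 (λ x y a b → (a :- x) :* (b :- (:- y)) :+ (a :- (:- x)) :* (b :- y)
                         := (a :* b :- x :* y) :+ (a :* b :- x :* y)) refl x y a b)
      (+-pos (*-pos (x<y⇒0<y-x p) (x<y⇒0<y-x q′)) (*-pos (x<y⇒0<y-x q) (x<y⇒0<y-x p′)))))

module Complex {c ℓ₁ ℓ₂} (R : RealField c ℓ₁ ℓ₂) where
  private module ℝ = RealField R
  open OrderProperties R

  infix 5 _+i_
  record ℂ : Set c where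
    constructor _+i_
    field
      re im : ℝ.Carrier
  open ℂ public

  rawRing : RawRing c ℓ₁
  rawRing = record
    { Carrier = ℂ
    ; _≈_     = λ z w → re z ℝ.≈ re w × im z ℝ.≈ im w
    ; _+_     = λ z w → re z ℝ.+ re w +i im z ℝ.+ im w
    ; _*_     = λ z w → re z ℝ.* re w ℝ.- im z ℝ.* im w +i re z ℝ.* im w ℝ.+ im z ℝ.* re w
    ; -_      = λ z → ℝ.- re z +i ℝ.- im z
    ; 0#      = ℝ.0# +i ℝ.0#
    ; 1#      = ℝ.1# +i ℝ.0#
    }

  open RawRing rawRing public hiding (Carrier)
  open Algebra.Definitions.RawSemiring rawSemiring public using (_^_; product)

  infixl 6 _-_
  _-_ : ℂ → ℂ → ℂ
  z - w = z + - w

  -- Being invertible is the positive form of being nonzero.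
  Invertible : ℂ → Set (c ⊔ ℓ₁)
  Invertible = Algebra.Definitions.Invertible _≈_ 1# _*_

  infix 8 _⁻¹
  _⁻¹ : ∀ {z} → Invertible z → ℂ
  (z⁻¹ , _) ⁻¹ = z⁻¹

  expTerm : ℂ → ℕ → ℂ
  expTerm z k = 1/k! ℝ.* re (z ^ k) +i 1/k! ℝ.* im (z ^ k)
    where 1/k! = recip (k !) {{k ℕ.!≢0}}

  expSum : ℂ → ℕ → ℂ
  expSum z zero    = 0#
  expSum z (suc p) = expSum z p + expTerm z p

  -- The partial sums are Cauchy: with B bounding the coordinates of z, d = 2B and
  -- C = 2 d ^ (2d) + 1, the coordinates of the term of index j + 2d are below C / 2ʲ.
  private
    open RealField R using (fromℕ)
    open IntegerCoefficients ℝ.commutativeRing using (solve; _:+_; _:*_; _:-_; :-_; _:=_)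

    infix 4 _≺_
    _≺_ : ℂ → ℝ.Carrier → Set ℓ₂
    z ≺ b = re z ◁ b × im z ◁ b

    bounded : ∀ z → ∃[ B ] z ≺ fromℕ B
    bounded (x +i y) =
      let a , x<a   = ℝ.archimedean x
          b , -x<b  = ℝ.archimedean (ℝ.- x)
          c , y<c   = ℝ.archimedean y
          d , -y<d  = ℝ.archimedean (ℝ.- y)
          s = suc ((a ℕ.+ b) ℕ.+ (c ℕ.+ d))
          a+b≤ = ℕ.m≤m+n (a ℕ.+ b) (c ℕ.+ d)
          c+d≤ = ℕ.m≤n+m (c ℕ.+ d) (a ℕ.+ b)
          up : ∀ {x e} → x ℝ.< fromℕ e → e ℕ.≤ (a ℕ.+ b) ℕ.+ (c ℕ.+ d) → x ℝ.< fromℕ s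
          up x<e e≤ = <-trans x<e (fromℕ-mono-< (ℕ.s≤s e≤))
      in s , (up x<a (ℕ.≤-trans (ℕ.m≤m+n a b) a+b≤) , up -x<b (ℕ.≤-trans (ℕ.m≤n+m b a) a+b≤))
           , (up y<c (ℕ.≤-trans (ℕ.m≤m+n c d) c+d≤) , up -y<d (ℕ.≤-trans (ℕ.m≤n+m d c) c+d≤))

    *-bound : ∀ {z w} a b → z ≺ fromℕ a → w ≺ fromℕ b → z * w ≺ fromℕ ((a ℕ.+ a) ℕ.* b)
    *-bound a b (p , q) (p′ , q′) =
        ◁-resp ℝ.refl eq (◁-+ (◁-* p p′) (◁-neg (◁-* q q′)))
      , ◁-resp ℝ.refl eq (◁-+ (◁-* p q′) (◁-* q p′))
      where
      eq : fromℕ a ℝ.* fromℕ b ℝ.+ fromℕ a ℝ.* fromℕ b ℝ.≈ fromℕ ((a ℕ.+ a) ℕ.* b)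
      eq = ℝ.sym (ℝ.trans (fromℕ-homo-* (a ℕ.+ a) b)
             (ℝ.trans (ℝ.*-congʳ (fromℕ-homo-+ a a)) (ℝ.distribʳ _ _ _)))

    ^-bound : ∀ {z} B → z ≺ fromℕ B → ∀ k → z ^ k ≺ fromℕ (2 ℕ.* (B ℕ.+ B) ℕ.^ k)
    ^-bound B z≺B zero    =
        ( <-respˡ (ℝ.+-identityʳ ℝ.1#) (fromℕ-mono-< {1} {2} ℕ.≤-refl)
        , <-trans -1<0 (fromℕ-pos 1))
      , 0◁ (fromℕ-pos 1)
      where
      -1<0 : ℝ.- ℝ.1# ℝ.< ℝ.0#
      -1<0 = 0<y-x⇒x<y (<-respʳ (ℝ.sym (ℝ.trans (ℝ.+-identityˡ _)
               (solve 1 (λ x → :- (:- x) := x) ℝ.refl ℝ.1#))) 0<1)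
    ^-bound {z} B z≺B (suc k) = ≡.subst (λ b → z ^ suc k ≺ fromℕ b) eq
                              (*-bound B (2 ℕ.* d ℕ.^ k) z≺B (^-bound B z≺B k))
      where
      d = B ℕ.+ B
      eq : d ℕ.* (2 ℕ.* d ℕ.^ k) ≡ 2 ℕ.* (d ℕ.* d ℕ.^ k)
      eq = ≡.trans (≡.sym (ℕ.*-assoc d 2 _))
             (≡.trans (≡.cong (ℕ._* d ℕ.^ k) (ℕ.*-comm d 2)) (ℕ.*-assoc 2 d _))

    2^*^≤! : ∀ d j → 2 ℕ.^ j ℕ.* d ℕ.^ j ℕ.≤ (j ℕ.+ 2 ℕ.* d) !
    2^*^≤! d zero    = ℕ.1≤n! (2 ℕ.* d)
    2^*^≤! d (suc j) = ℕ.≤-trans (ℕ.≤-reflexive regroup)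
                         (ℕ.*-mono-≤ (ℕ.m≤n+m (2 ℕ.* d) (suc j)) (2^*^≤! d j))
      where
      open +-*-Solver using (con) renaming (_:*_ to _⊛_; _:=_ to _⊜_)
      regroup : (2 ℕ.* 2 ℕ.^ j) ℕ.* (d ℕ.* d ℕ.^ j) ≡ (2 ℕ.* d) ℕ.* (2 ℕ.^ j ℕ.* d ℕ.^ j)
      regroup = +-*-Solver.solve 3 (λ x y w → (con 2 ⊛ x) ⊛ (y ⊛ w) ⊜ (con 2 ⊛ y) ⊛ (x ⊛ w))
                  ≡.refl (2 ℕ.^ j) d (d ℕ.^ j)

    module Tail (z : ℂ) (B : ℕ) (z≺B : z ≺ fromℕ B) where
      d K C : ℕ
      d = B ℕ.+ B
      K = 2 ℕ.* d
      C = suc (2 ℕ.* d ℕ.^ K)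

      term-bound-ℕ : ∀ j → 2 ℕ.* d ℕ.^ (j ℕ.+ K) ℕ.* 2 ℕ.^ j ℕ.< C ℕ.* (j ℕ.+ K) !
      term-bound-ℕ j = begin-strict
        2 ℕ.* d ℕ.^ (j ℕ.+ K) ℕ.* 2 ℕ.^ j
          ≡⟨ ≡.cong (λ e → 2 ℕ.* e ℕ.* 2 ℕ.^ j) (ℕ.^-distribˡ-+-* d j K) ⟩
        2 ℕ.* (d ℕ.^ j ℕ.* d ℕ.^ K) ℕ.* 2 ℕ.^ j
          ≡⟨ +-*-Solver.solve 3 (λ x y w → con 2 ⊛ (x ⊛ y) ⊛ w ⊜ (con 2 ⊛ y) ⊛ (w ⊛ x))
               ≡.refl (d ℕ.^ j) (d ℕ.^ K) (2 ℕ.^ j) ⟩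
        (2 ℕ.* d ℕ.^ K) ℕ.* (2 ℕ.^ j ℕ.* d ℕ.^ j)
          ≤⟨ ℕ.*-monoʳ-≤ (2 ℕ.* d ℕ.^ K) (2^*^≤! d j) ⟩
        (2 ℕ.* d ℕ.^ K) ℕ.* (j ℕ.+ K) !      <⟨ ℕ.m<n+m _ (ℕ.1≤n! (j ℕ.+ K)) ⟩
        C ℕ.* (j ℕ.+ K) !                    ∎
        where
        open ℕ.≤-Reasoning
        open +-*-Solver using (con) renaming (_:*_ to _⊛_; _:=_ to _⊜_)

      term-bound : ∀ j → expTerm z (j ℕ.+ K) ≺ C ÷2^ j
      term-bound j = scaled (proj₁ z^k≺) , scaled (proj₂ z^k≺)
        where
        k = j ℕ.+ K
        instance
          k!≢0 : NonZero (k !)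
          k!≢0 = k ℕ.!≢0
        z^k≺ : z ^ k ≺ fromℕ (2 ℕ.* d ℕ.^ k)
        z^k≺ = ^-bound B z≺B k
        scaled : ∀ {x} → x ◁ fromℕ (2 ℕ.* d ℕ.^ k) → recip (k !) ℝ.* x ◁ C ÷2^ j
        scaled p = ◁-weaken
          (<-respˡ (ℝ.*-comm _ _)
            (÷-mono-< {2 ℕ.* d ℕ.^ k} {C} (k !) (2 ℕ.^ j) {{k!≢0}} {{ℕ.m^n≢0 2 j}} (term-bound-ℕ j)))
          (◁-scale (recip (k !)) (recip-pos (k !)) p)

      tail : ℕ → ℕ → ℂ
      tail p zero    = 0#
      tail p (suc i) = expTerm z p + tail (suc p) i

      expSum-tail : ∀ i p → expSum z (i ℕ.+ p) ≈ expSum z p + tail p i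
      expSum-tail zero    p = ℝ.sym (ℝ.+-identityʳ _) , ℝ.sym (ℝ.+-identityʳ _)
      expSum-tail (suc i) p with expSum-tail i (suc p)
      ... | e rewrite ℕ.+-suc i p =
        ℝ.trans (proj₁ e) (ℝ.+-assoc _ _ _) , ℝ.trans (proj₂ e) (ℝ.+-assoc _ _ _)

      C÷2^j>0 : ∀ j → ℝ.0# ℝ.< C ÷2^ j
      C÷2^j>0 j = ℝ.*-pos (fromℕ-pos (2 ℕ.* d ℕ.^ K)) (recip-pos (2 ℕ.^ j) {{ℕ.m^n≢0 2 j}})

      tail-bound : ∀ i j → tail (j ℕ.+ K) i ≺ C ÷2^ j ℝ.+ C ÷2^ j
      tail-bound zero    j = 0◁ pos , 0◁ pos
        where pos = +-pos (C÷2^j>0 j) (C÷2^j>0 j)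
      tail-bound (suc i) j = combine (proj₁ t) (proj₁ T) , combine (proj₂ t) (proj₂ T)
        where
        t = term-bound j
        T = tail-bound i (suc j)
        combine : ∀ {x y} → x ◁ C ÷2^ j → y ◁ C ÷2^ suc j ℝ.+ C ÷2^ suc j →
                  x ℝ.+ y ◁ C ÷2^ j ℝ.+ C ÷2^ j
        combine p q = ◁-resp ℝ.refl (ℝ.+-congˡ (÷2^-halves C j)) (◁-+ p q)

      cauchy : (f : ℂ → ℝ.Carrier) →
               (∀ {v w} → v ≈ w → f v ℝ.≈ f w) →
               (∀ v w → f (v + w) ℝ.≈ f v ℝ.+ f w) →
               (∀ {v b} → v ≺ b → f v ◁ b) →
               ℝ.Cauchy (λ p → f (expSum z p))
      cauchy f f-cong f-+ f-◁ ε 0<ε = N , λ p q N≤p N≤q →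
        <-trans (<-respˡ (eq p q N≤p N≤q) (<-respʳ halves (proj₁ (small (p ℕ.∸ N) (q ℕ.∸ N)))))
                (proj₂ (÷2^-small C 0<ε))
        where
        j N : ℕ
        j = proj₁ (÷2^-small C 0<ε)
        N = suc (suc j) ℕ.+ K
        r : ℝ.Carrier
        r = C ÷2^ suc (suc j) ℝ.+ C ÷2^ suc (suc j)
        halves : r ℝ.+ r ℝ.≈ C ÷2^ j
        halves = ℝ.trans (ℝ.+-cong (÷2^-halves C (suc j)) (÷2^-halves C (suc j))) (÷2^-halves C j)
        small : ∀ a b → f (tail N a) ℝ.- f (tail N b) ◁ r ℝ.+ r
        small a b = ◁-+ (f-◁ (tail-bound a (suc (suc j)))) (◁-neg (f-◁ (tail-bound b (suc (suc j)))))
        split : ∀ p → N ℕ.≤ p → f (expSum z p) ℝ.≈ f (expSum z N) ℝ.+ f (tail N (p ℕ.∸ N))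
        split p N≤p = ℝ.trans
          (ℝ.reflexive (≡.cong (λ p → f (expSum z p)) (≡.sym (ℕ.m∸n+n≡m N≤p))))
          (ℝ.trans (f-cong (expSum-tail (p ℕ.∸ N) N)) (f-+ _ _))
        eq : ∀ p q → N ℕ.≤ p → N ℕ.≤ q →
             f (tail N (p ℕ.∸ N)) ℝ.- f (tail N (q ℕ.∸ N)) ℝ.≈ f (expSum z p) ℝ.- f (expSum z q)
        eq p q N≤p N≤q = ℝ.sym (ℝ.trans
          (ℝ.+-cong (split p N≤p) (ℝ.-‿cong (split q N≤q)))
          (solve 3 (λ s x y → (s :+ x) :- (s :+ y) := x :- y) ℝ.refl _ _ _))

  abstract
    expSum-re-cauchy : ∀ z → ℝ.Cauchy (λ p → re (expSum z p))
    expSum-re-cauchy z = Tail.cauchy z (proj₁ (bounded z)) (proj₂ (bounded z)) re proj₁ (λ _ _ → ℝ.refl) proj₁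

    expSum-im-cauchy : ∀ z → ℝ.Cauchy (λ p → im (expSum z p))
    expSum-im-cauchy z = Tail.cauchy z (proj₁ (bounded z)) (proj₂ (bounded z)) im proj₂ (λ _ _ → ℝ.refl) proj₂

  exp : ℂ → ℂ
  exp z = proj₁ (ℝ.complete (λ p → re (expSum z p)) (expSum-re-cauchy z))
       +i proj₁ (ℝ.complete (λ p → im (expSum z p)) (expSum-im-cauchy z))

  sin : ℝ.Carrier → ℝ.Carrier
  sin x = im (exp (ℝ.0# +i x))

  -- π is the least positive zero of the sine; "nonzero" in between is apartness.
  IsPi : ℝ.Carrier → Set (c ⊔ ℓ₁ ⊔ ℓ₂)
  IsPi π = ℝ.0# ℝ.< π
         × sin π ℝ.≈ ℝ.0#
         × (∀ x → ℝ.0# ℝ.< x → x ℝ.< π → sin x ℝ.# ℝ.0#)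

  -- e^(2πi/n), for π satisfying IsPi.
  ζ : ℝ.Carrier → ∀ n → .{{NonZero n}} → ℂ
  ζ π n = exp (ℝ.0# +i (ℝ.1# ℝ.+ ℝ.1#) ℝ.* π ℝ.* recip n)

  -- All x_{j₁}, …, x_{jₘ} with j₁ < … < jₘ.
  choose : ∀ {a} {A : Set a} → ℕ → List A → List (List A)
  choose zero    xs       = [] ∷ []
  choose (suc m) []       = []
  choose (suc m) (x ∷ xs) = map (x ∷_) (choose m xs) ++ choose (suc m) xs

  𝓔 : ℕ → List ℂ → ℂ
  𝓔 m zs = foldr _+_ 0# (map (foldr _*_ 1#) (choose m zs))

{-# OPTIONS --safe #-}

-- Write q = ζₙ and E k m = 𝓔 m (1 , q , … , q ^ (k - 1)).  The Pascal rule for E gives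
-- (1 - q ^ (m + 1)) E k (m + 1) = (q ^ m - q ^ k) E k m for every q, and the closed form
-- satisfies the same recurrence because q ^ n = 1; so induction on m works as soon as
-- 1 - q ^ j is invertible for 0 < j < n.
--
-- Both facts about q rest on exp (z + w) = exp z exp w.  For sequences, u = (zᵏ / k!)
-- is determined by (k + 1) uₖ₊₁ = z uₖ, u₀ = 1, and the Cauchy product of the sequences
-- of z and w satisfies the recurrence of z + w.  What the square of partial sums has
-- beyond that of z + w is dominated by A(p)² - A(p/2)² for the partial sums A of a real
-- exponential series, which tends to 0.
--
-- With c = exp(iπj/n), on the unit circle, q ^ j = c² and 1 - c² = c (c̄ - c), a unit
-- times the sine of πj/n, which is apart from 0 by the minimality of π.  For j = n the
-- sine vanishes, so c = c̄ and q ^ n = c c̄ = 1.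
module Submission where

open import Defs
open import Algebra.Bundles using (CommutativeRing; Semiring)
import Algebra.Apartness.Properties.HeytingCommutativeRing
import Algebra.Definitions
import Algebra.Definitions.RawSemiring
import Algebra.Properties.CommutativeMonoid.Sum
import Algebra.Properties.CommutativeSemiring.Exp
import Algebra.Properties.Group
import Algebra.Properties.Ring
import Algebra.Properties.Semiring.Exp
import Algebra.Properties.Semiring.Mult
import Algebra.Structures
open import Data.Fin.Base using (Fin; toℕ)
import Data.Fin.Properties as Fin
open import Data.List.Base using (List; []; _∷_; _++_; map; foldr; applyUpTo)
import Data.List.Properties as List
open import Data.Nat.Base as ℕ using (ℕ; NonZero; zero; suc; _∸_; _!; ⌊_/2⌋)
import Data.Nat.Properties as ℕ
open import Data.Product.Base using (_×_; Σ-syntax; ∃-syntax; _,_; proj₁; proj₂)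
open import Data.Sum.Base using (inj₁; inj₂)
open import Function.Base using (_∘_)
open import Function.Bundles using (module Equivalence)
open import Level using (_⊔_)
open import Relation.Binary.PropositionalEquality as ≡ using (_≡_)
open import Relation.Nullary.Negation using (¬_; contradiction)

-- The Gaussian Pascal recurrence and its closed form, over any commutative ring.

module GaussianPascal {c ℓ} (R : CommutativeRing c ℓ) where
  open CommutativeRing R
  open Algebra.Definitions _≈_ using (Invertible)
  open Algebra.Definitions.RawSemiring (Semiring.rawSemiring semiring) using (product)
  open Algebra.Properties.Ring ring using (-1*x≈-x; x[y-z]≈xy-xz)
  open Algebra.Properties.Semiring.Exp semiring using (_^_; ^-congʳ; ^-homo-*)
  open Algebra.Properties.CommutativeMonoid.Sum *-commutativeMonoid using ()
    renaming (∑-distrib-+ to product-distrib-*; sum-cong-≋ to product-cong)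
  open IntegerCoefficients R using (solve; _:+_; _:*_; _:-_; :-_; _:=_)
  open import Relation.Binary.Reasoning.Setoid setoid

  *-cancelˡ-invertible : ∀ {u x y} → Invertible 1# _*_ u → u * x ≈ u * y → x ≈ y
  *-cancelˡ-invertible {u} {x} {y} (u⁻¹ , u⁻¹u≈1 , _) ux≈uy = begin
    x             ≈⟨ *-identityˡ x ⟨
    1# * x        ≈⟨ *-congʳ u⁻¹u≈1 ⟨
    u⁻¹ * u * x   ≈⟨ *-assoc _ _ _ ⟩
    u⁻¹ * (u * x) ≈⟨ *-congˡ ux≈uy ⟩
    u⁻¹ * (u * y) ≈⟨ *-assoc _ _ _ ⟨
    u⁻¹ * u * y   ≈⟨ *-congʳ u⁻¹u≈1 ⟩
    1# * y        ≈⟨ *-identityˡ y ⟩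
    y             ∎

  x[1-y]≈x-xy : ∀ x y → x * (1# - y) ≈ x - x * y
  x[1-y]≈x-xy x y = trans (x[y-z]≈xy-xz x 1# y) (+-congʳ (*-identityʳ x))

  product-1# : ∀ d {f : Fin d → Carrier} → (∀ j → f j ≈ 1#) → product f ≈ 1#
  product-1# zero    f≈1 = refl
  product-1# (suc d) f≈1 =
    trans (*-cong (f≈1 Fin.zero) (product-1# d (λ j → f≈1 (Fin.suc j)))) (*-identityˡ 1#)

  -- Both sides multiply the factors h 0, ..., h d, with the first or the last one split off.
  -- Shifting the index of a product thus exchanges only its end factors.
  product-shift : ∀ d (h : ℕ → Carrier) →
    h 0 * product {d} (λ j → h (suc (toℕ j))) ≈ product {d} (λ j → h (toℕ j)) * h d
  product-shift zero    h = *-comm _ _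
  product-shift (suc d) h =
    trans (*-congˡ (product-shift d (λ i → h (suc i)))) (sym (*-assoc _ _ _))

  -- The hypotheses are those satisfied by E k m = 𝓔 m (1 , q , … , q ^ (k - 1)).
  module _ (q : Carrier) (E : ℕ → ℕ → Carrier)
           (E-zero  : ∀ k → E k 0 ≈ 1#)
           (E-empty : ∀ m → E 0 (suc m) ≈ 0#)
           (E-suc   : ∀ k m → E (suc k) (suc m) ≈ q ^ m * E k m + q ^ suc m * E k (suc m))
           where

    -- Induction on `k`: the Pascal rule expands the left side, the hypotheses at `m + 1` and at `m`
    -- replace two of the products, and the Pascal rule read backwards collects the result. Nothing
    -- is divided, so `q` is arbitrary.
    E-ratio : ∀ k m → (1# - q ^ suc m) * E k (suc m) ≈ (q ^ m - q ^ k) * E k m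
    E-ratio zero zero    = trans (*-congˡ (E-empty 0))
      (trans (zeroʳ _) (sym (trans (*-congʳ (-‿inverseʳ 1#)) (zeroˡ _))))
    E-ratio zero (suc m) = trans (*-congˡ (E-empty (suc m)))
      (trans (zeroʳ _) (sym (trans (*-congˡ (E-empty m)) (zeroʳ _))))
    E-ratio (suc k) zero = begin
      (1# - q ^ 1) * E (suc k) 1                   ≈⟨ *-congˡ (E-suc k 0) ⟩
      (1# - q ^ 1) * (1# * E k 0 + q ^ 1 * E k 1)
        ≈⟨ solve 4 (λ o x e e′ → (o :- x) :* (o :* e :+ x :* e′) := (o :- x) :* (o :* e) :+ x :* ((o :- x) :* e′))
             refl 1# (q ^ 1) (E k 0) (E k 1) ⟩
      (1# - q ^ 1) * (1# * E k 0) + q ^ 1 * ((1# - q ^ 1) * E k 1)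
        ≈⟨ +-cong (*-congˡ (trans (*-identityˡ _) (E-zero k)))
                  (*-congˡ (trans (E-ratio k 0) (trans (*-congˡ (E-zero k)) (*-identityʳ _)))) ⟩
      (1# - q ^ 1) * 1# + q ^ 1 * (1# - q ^ k)     ≈⟨ +-cong (*-identityʳ _) (x[1-y]≈x-xy _ _) ⟩
      (1# - q ^ 1) + (q ^ 1 - q ^ 1 * q ^ k)
        ≈⟨ solve 3 (λ o x y → (o :- x) :+ (x :- x :* y) := o :- x :* y) refl 1# (q ^ 1) (q ^ k) ⟩
      1# - q ^ 1 * q ^ k                           ≈⟨ +-congˡ (-‿cong (*-congʳ (*-identityʳ q))) ⟩
      1# - q ^ suc k                               ≈⟨ *-identityʳ _ ⟨
      (1# - q ^ suc k) * 1#                        ≈⟨ *-congˡ (E-zero (suc k)) ⟨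
      (1# - q ^ suc k) * E (suc k) 0               ∎
    E-ratio (suc k) (suc m) = begin
      (1# - q ^ (2 ℕ.+ m)) * E (suc k) (2 ℕ.+ m) ≈⟨ *-congˡ (E-suc k (suc m)) ⟩
      (1# - q * x) * (x * e + q * x * e″)
        ≈⟨ solve 5 (λ o q x e e″ → (o :- q :* x) :* (x :* e :+ q :* x :* e″)
             := (o :- q :* x) :* (x :* e) :+ q :* x :* ((o :- q :* x) :* e″)) refl 1# q x e e″ ⟩
      (1# - q * x) * (x * e) + q * x * ((1# - q * x) * e″)
        ≈⟨ +-congˡ (*-congˡ (E-ratio k (suc m))) ⟩
      (1# - q * x) * (x * e) + q * x * ((x - y) * e)
        -- The regrouping isolates `(1# - x) * e`, the left side of the hypothesis at `m`, which
        -- brings in `e′`.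
        ≈⟨ solve 5 (λ o q x y e → (o :- q :* x) :* (x :* e) :+ q :* x :* ((x :- y) :* e)
             := (x :- q :* y) :* (x :* e) :+ x :* ((o :- x) :* e)) refl 1# q x y e ⟩
      (x - q * y) * (x * e) + x * ((1# - x) * e)
        ≈⟨ +-congˡ (*-congˡ (E-ratio k m)) ⟩
      (x - q * y) * (x * e) + q * z * ((z - y) * e′)
        ≈⟨ solve 5 (λ q z y e e′ → (q :* z :- q :* y) :* (q :* z :* e) :+ q :* z :* ((z :- y) :* e′)
             := (q :* z :- q :* y) :* (z :* e′ :+ q :* z :* e)) refl q z y e e′ ⟩
      (x - q * y) * (z * e′ + q * z * e)         ≈⟨ *-congˡ (E-suc k m) ⟨
      (q ^ suc m - q ^ suc k) * E (suc k) (suc m) ∎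
      where
      x y z e e′ e″ : Carrier
      x = q ^ suc m ; y = q ^ k ; z = q ^ m
      e′ = E k m ; e = E k (suc m) ; e″ = E k (2 ℕ.+ m)

    -- Here `d` is n - k - 1, given by an equation to avoid truncated subtraction; `d = 0` is
    -- allowed and covers k = n - 1. The inverses `inv` are a parameter of their own, so that the
    -- formula holds for whichever inverses are used to write the quotients.
    module _ (n : ℕ) (qⁿ≈1 : q ^ n ≈ 1#)
             (1-qʲ-invertible : ∀ j → suc j ℕ.< n → Invertible 1# _*_ (1# - q ^ suc j))
             (k d : ℕ) (k+1+d≡n : k ℕ.+ suc d ≡ n)
             (inv : ∀ (j : Fin d) → Invertible 1# _*_ (1# - q ^ suc (toℕ j)))
             where

      -- The Gaussian binomial coefficient of m + d over d at `q`.
      quotients : ℕ → Carrier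
      quotients m = product (λ j → (1# - q ^ (m ℕ.+ suc (toℕ j))) * proj₁ (inv j))

      -- The denominators do not depend on `m` and are pulled out as `D`. Among the numerators the
      -- step from `m` to `m + 1` loses only the exponent m + 1 and gains only m + 1 + d.
      quotients-suc : ∀ m → (1# - q ^ suc m) * quotients (suc m) ≈ quotients m * (1# - q ^ (suc m ℕ.+ d))
      quotients-suc m = begin
        (1# - q ^ suc m) * quotients (suc m)
          ≈⟨ *-congˡ (product-distrib-* (λ j → h (suc (toℕ j))) (λ j → proj₁ (inv j))) ⟩
        (1# - q ^ suc m) * (product {d} (λ j → h (suc (toℕ j))) * D)
          ≈⟨ *-assoc _ _ _ ⟨
        (1# - q ^ suc m) * product {d} (λ j → h (suc (toℕ j))) * D
          ≈⟨ *-congʳ (*-congʳ (exponent (≡.sym (ℕ.+-identityʳ (suc m))))) ⟩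
        h 0 * product {d} (λ j → h (suc (toℕ j))) * D
          ≈⟨ *-congʳ (product-shift d h) ⟩
        product {d} (λ j → h (toℕ j)) * h d * D
          ≈⟨ solve 3 (λ x y z → x :* y :* z := x :* z :* y) refl _ _ _ ⟩
        product {d} (λ j → h (toℕ j)) * D * h d
          ≈⟨ *-congʳ (*-congʳ (product-cong {d} (λ j → exponent (≡.sym (ℕ.+-suc m (toℕ j)))))) ⟩
        product {d} (λ j → 1# - q ^ (m ℕ.+ suc (toℕ j))) * D * h d
          ≈⟨ *-congʳ (product-distrib-* {d} (λ j → 1# - q ^ (m ℕ.+ suc (toℕ j))) (λ j → proj₁ (inv j))) ⟨
        quotients m * h d ∎
        where
        h : ℕ → Carrier
        h i = 1# - q ^ (suc m ℕ.+ i)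
        D : Carrier
        D = product {d} (λ j → proj₁ (inv j))
        exponent : ∀ {a b} → a ≡ b → 1# - q ^ a ≈ 1# - q ^ b
        exponent a≡b = +-congˡ (-‿cong (^-congʳ q a≡b))

      -- Induction on `m`: `E-ratio` and `quotients-suc` are the same recurrence once q ^ n = 1, and
      -- the factor 1 - q ^ (m + 1) can be cancelled because m + 1 ≤ k < n.
      E-closed : ∀ m → m ℕ.≤ k → E k m ≈ (- 1#) ^ m * q ^ (m ℕ.* k) * quotients m
      E-closed zero    _   = begin
        E k 0                   ≈⟨ E-zero k ⟩
        1#                      ≈⟨ *-identityˡ 1# ⟨
        1# * 1#                 ≈⟨ *-congˡ (product-1# d (λ j → proj₂ (proj₂ (inv j)))) ⟨
        1# * quotients 0        ≈⟨ *-congʳ (*-identityˡ 1#) ⟨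
        1# * 1# * quotients 0   ∎
      E-closed (suc m) m<k = *-cancelˡ-invertible
        (1-qʲ-invertible m (ℕ.<-≤-trans (ℕ.s≤s m<k)
           (≡.subst (suc k ℕ.≤_) (≡.trans (≡.sym (ℕ.+-suc k d)) k+1+d≡n) (ℕ.s≤s (ℕ.m≤m+n k d)))))
        (begin
          (1# - q ^ suc m) * E k (suc m)          ≈⟨ E-ratio k m ⟩
          -- As k + (m + 1 + d) = m + n, the power q ^ m equals q ^ k * y; then q ^ k factors out
          -- and leaves the sign and the factor 1 - y.
          (q ^ m - q ^ k) * E k m                 ≈⟨ *-cong (+-congʳ (sym qᵏqᵐ⁺¹⁺ᵈ≈qᵐ)) (E-closed m (ℕ.<⇒≤ m<k)) ⟩
          (q ^ k * y - q ^ k) * (s * w * quotients m)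
            ≈⟨ solve 5 (λ a y s w p → (a :* y :- a) :* (s :* w :* p)
                 := (:- s) :* (a :* w) :* (p :- p :* y))
                 refl (q ^ k) y s w (quotients m) ⟩
          - s * (q ^ k * w) * (quotients m - quotients m * y)
            ≈⟨ *-cong (*-congʳ (-1*x≈-x s)) (x[1-y]≈x-xy _ _) ⟨
          - 1# * s * (q ^ k * w) * (quotients m * (1# - y))
            ≈⟨ *-congˡ (quotients-suc m) ⟨
          - 1# * s * (q ^ k * w) * ((1# - q ^ suc m) * quotients (suc m))
            ≈⟨ solve 3 (λ x y z → x :* (y :* z) := y :* (x :* z)) refl _ _ _ ⟩
          (1# - q ^ suc m) * (- 1# * s * (q ^ k * w) * quotients (suc m))
            ≈⟨ *-congˡ (*-congʳ (*-congˡ (^-homo-* q k (m ℕ.* k)))) ⟨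
          (1# - q ^ suc m) * ((- 1#) ^ suc m * q ^ (suc m ℕ.* k) * quotients (suc m)) ∎)
        where
        s w y : Carrier
        s = (- 1#) ^ m ; w = q ^ (m ℕ.* k) ; y = q ^ (suc m ℕ.+ d)
        qᵏqᵐ⁺¹⁺ᵈ≈qᵐ : q ^ k * y ≈ q ^ m
        qᵏqᵐ⁺¹⁺ᵈ≈qᵐ = begin
          q ^ k * q ^ (suc m ℕ.+ d)    ≈⟨ ^-homo-* q k (suc m ℕ.+ d) ⟨
          q ^ (k ℕ.+ (suc m ℕ.+ d))
            ≈⟨ ^-congʳ q (≡.trans (≡.cong (k ℕ.+_) (≡.sym (ℕ.+-suc m d)))
                 (≡.trans (≡.sym (ℕ.+-assoc k m (suc d)))
                   (≡.trans (≡.cong (ℕ._+ suc d) (ℕ.+-comm k m)) (≡.trans (ℕ.+-assoc m k (suc d)) (≡.cong (m ℕ.+_) k+1+d≡n))))) ⟩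
          q ^ (m ℕ.+ n)                ≈⟨ ^-homo-* q m n ⟩
          q ^ m * q ^ n                ≈⟨ *-congˡ qⁿ≈1 ⟩
          q ^ m * 1#                   ≈⟨ *-identityʳ _ ⟩
          q ^ m                        ∎

-- The commutative ring of complex numbers, checked coordinatewise.

module ComplexRing {c ℓ₁ ℓ₂} (R : RealField c ℓ₁ ℓ₂) where
  private module ℝ = RealField R
  open Complex R
  open IntegerCoefficients ℝ.commutativeRing using (solve; _:+_; _:*_; _:-_; _:=_)

  open Algebra.Structures _≈_ using (IsCommutativeRing)
  open Algebra.Definitions _≈_ using (Associative; Commutative; _DistributesOverʳ_)

  private
    module P = Algebra.Properties.Ring (CommutativeRing.ring ℝ.commutativeRing)

    *-assoc : Associative _*_
    *-assoc (a +i b) (c +i d) (e +i f) =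
        solve 6 (λ a b c d e f → (a :* c :- b :* d) :* e :- (a :* d :+ b :* c) :* f
                              := a :* (c :* e :- d :* f) :- b :* (c :* f :+ d :* e))
          ℝ.refl a b c d e f
      , solve 6 (λ a b c d e f → (a :* c :- b :* d) :* f :+ (a :* d :+ b :* c) :* e
                              := a :* (c :* f :+ d :* e) :+ b :* (c :* e :- d :* f))
          ℝ.refl a b c d e f

    *-comm : Commutative _*_
    *-comm (a +i b) (c +i d) =
        ℝ.+-cong (ℝ.*-comm a c) (ℝ.-‿cong (ℝ.*-comm b d))
      , ℝ.trans (ℝ.+-comm _ _) (ℝ.+-cong (ℝ.*-comm b c) (ℝ.*-comm a d))

    distribˡ : ∀ z v w → z * (v + w) ≈ z * v + z * w
    distribˡ (a +i b) (c +i d) (e +i f) =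
        solve 6 (λ a b c d e f → a :* (c :+ e) :- b :* (d :+ f)
                              := (a :* c :- b :* d) :+ (a :* e :- b :* f)) ℝ.refl a b c d e f
      , solve 6 (λ a b c d e f → a :* (d :+ f) :+ b :* (c :+ e)
                              := (a :* d :+ b :* c) :+ (a :* f :+ b :* e)) ℝ.refl a b c d e f

    *-identityˡ : ∀ z → 1# * z ≈ z
    *-identityˡ (a +i b) =
        ℝ.trans (ℝ.+-cong (ℝ.*-identityˡ a) (ℝ.trans (ℝ.-‿cong (ℝ.zeroˡ b)) P.-0#≈0#)) (ℝ.+-identityʳ a)
      , ℝ.trans (ℝ.+-cong (ℝ.*-identityˡ b) (ℝ.zeroˡ a)) (ℝ.+-identityʳ b)

    +-cong : ∀ {v w x y} → v ≈ w → x ≈ y → v + x ≈ w + y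
    +-cong (p , q) (p′ , q′) = ℝ.+-cong p p′ , ℝ.+-cong q q′

    ≈-trans : ∀ {v w x} → v ≈ w → w ≈ x → v ≈ x
    ≈-trans (p , q) (p′ , q′) = ℝ.trans p p′ , ℝ.trans q q′

    distribʳ : _*_ DistributesOverʳ _+_
    distribʳ x y z = ≈-trans {w = x * (y + z)} (*-comm (y + z) x) (≈-trans {w = x * y + x * z} (distribˡ x y z)
      (+-cong {x * y} {y * x} {x * z} {z * x} (*-comm x y) (*-comm x z)))

  isCommutativeRing : IsCommutativeRing _+_ _*_ -_ 0# 1#
  isCommutativeRing = record
    { isRing = record
      { +-isAbelianGroup = record
        { isGroup = record
          { isMonoid = record
            { isSemigroup = record
              { isMagma = record
                { isEquivalence = record
                  { refl  = ℝ.refl , ℝ.refl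
                  ; sym   = λ (p , q) → ℝ.sym p , ℝ.sym q
                  ; trans = λ (p , q) (p′ , q′) → ℝ.trans p p′ , ℝ.trans q q′
                  }
                ; ∙-cong = λ (p , q) (p′ , q′) → ℝ.+-cong p p′ , ℝ.+-cong q q′
                }
              ; assoc = λ _ _ _ → ℝ.+-assoc _ _ _ , ℝ.+-assoc _ _ _
              }
            ; identity = (λ _ → ℝ.+-identityˡ _ , ℝ.+-identityˡ _)
                       , (λ _ → ℝ.+-identityʳ _ , ℝ.+-identityʳ _)
            }
          ; inverse = (λ _ → ℝ.-‿inverseˡ _ , ℝ.-‿inverseˡ _)
                    , (λ _ → ℝ.-‿inverseʳ _ , ℝ.-‿inverseʳ _)
          ; ⁻¹-cong = λ (p , q) → ℝ.-‿cong p , ℝ.-‿cong q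
          }
        ; comm = λ _ _ → ℝ.+-comm _ _ , ℝ.+-comm _ _
        }
      ; *-cong = λ (p , q) (p′ , q′) →
            ℝ.+-cong (ℝ.*-cong p p′) (ℝ.-‿cong (ℝ.*-cong q q′))
          , ℝ.+-cong (ℝ.*-cong p q′) (ℝ.*-cong q p′)
      ; *-assoc = *-assoc
      ; *-identity = *-identityˡ , λ z → ≈-trans {w = 1# * z} (*-comm z 1#) (*-identityˡ z)
      ; distrib = distribˡ , distribʳ
      }
    ; *-comm = *-comm
    }

  commutativeRing : CommutativeRing c ℓ₁
  commutativeRing = record { isCommutativeRing = isCommutativeRing }

-- Elementary symmetric polynomials of a geometric progression.

module ElementarySymmetric {c ℓ₁ ℓ₂} (R : RealField c ℓ₁ ℓ₂) where
  open Complex R using (ℂ; 𝓔; choose)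
  open CommutativeRing (ComplexRing.commutativeRing R)
  open Algebra.Properties.Semiring.Exp semiring using (_^_)
  open IntegerCoefficients (ComplexRing.commutativeRing R) using (solve; _:+_; _:*_; _:=_)
  open import Relation.Binary.Reasoning.Setoid setoid

  private
    Σ-products : List (List ℂ) → ℂ
    Σ-products xss = foldr _+_ 0# (map (foldr _*_ 1#) xss)

    Σ-products-++ : ∀ xss yss → Σ-products (xss ++ yss) ≈ Σ-products xss + Σ-products yss
    Σ-products-++ []         yss = sym (+-identityˡ _)
    Σ-products-++ (xs ∷ xss) yss = trans (+-congˡ {foldr _*_ 1# xs} (Σ-products-++ xss yss)) (sym (+-assoc _ _ _))

    Σ-products-map-∷ : ∀ z xss → Σ-products (map (z ∷_) xss) ≈ z * Σ-products xss
    Σ-products-map-∷ z []         = sym (zeroʳ z)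
    Σ-products-map-∷ z (xs ∷ xss) = trans (+-congˡ {z * foldr _*_ 1# xs} (Σ-products-map-∷ z xss)) (sym (distribˡ z _ _))

  𝓔-zero : ∀ zs → 𝓔 0 zs ≈ 1#
  𝓔-zero zs = +-identityʳ 1#

  -- The choices are split by whether they use the head `z`.
  𝓔-∷ : ∀ m z zs → 𝓔 (suc m) (z ∷ zs) ≈ z * 𝓔 m zs + 𝓔 (suc m) zs
  𝓔-∷ m z zs = trans (Σ-products-++ (map (z ∷_) (choose m zs)) (choose (suc m) zs))
                     (+-congʳ {𝓔 (suc m) zs} (Σ-products-map-∷ z (choose m zs)))

  -- Homogeneity of degree `m`.
  𝓔-scale : ∀ q m zs → 𝓔 m (map (q *_) zs) ≈ q ^ m * 𝓔 m zs
  𝓔-scale q zero    zs       = sym (*-identityˡ (𝓔 0 zs))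
  𝓔-scale q (suc m) []       = sym (zeroʳ (q ^ suc m))
  𝓔-scale q (suc m) (z ∷ zs) = begin
    𝓔 (suc m) (q * z ∷ map (q *_) zs)
      ≈⟨ 𝓔-∷ m (q * z) (map (q *_) zs) ⟩
    q * z * 𝓔 m (map (q *_) zs) + 𝓔 (suc m) (map (q *_) zs)
      ≈⟨ +-cong (*-congˡ {q * z} (𝓔-scale q m zs)) (𝓔-scale q (suc m) zs) ⟩
    q * z * (q ^ m * 𝓔 m zs) + q ^ suc m * 𝓔 (suc m) zs
      ≈⟨ solve 5 (λ q z x e e′ → q :* z :* (x :* e) :+ q :* x :* e′ := q :* x :* (z :* e :+ e′))
           refl q z (q ^ m) (𝓔 m zs) (𝓔 (suc m) zs) ⟩
    q ^ suc m * (z * 𝓔 m zs + 𝓔 (suc m) zs)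
      ≈⟨ *-congˡ {q ^ suc m} (𝓔-∷ m z zs) ⟨
    q ^ suc m * 𝓔 (suc m) (z ∷ zs) ∎

  -- Without its head 1 the progression of length k + 1 is `q` times the one of length `k`, so
  -- homogeneity turns the splitting by the head into the Pascal rule.
  𝓔-geometric : ∀ q k m → 𝓔 (suc m) (applyUpTo (q ^_) (suc k))
    ≈ q ^ m * 𝓔 m (applyUpTo (q ^_) k) + q ^ suc m * 𝓔 (suc m) (applyUpTo (q ^_) k)
  𝓔-geometric q k m = begin
    𝓔 (suc m) (1# ∷ applyUpTo (λ i → q * q ^ i) k)
      ≡⟨ ≡.cong (λ zs → 𝓔 (suc m) (1# ∷ zs)) (List.map-applyUpTo (q ^_) (q *_) k) ⟨
    𝓔 (suc m) (1# ∷ map (q *_) zs)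
      ≈⟨ 𝓔-∷ m 1# (map (q *_) zs) ⟩
    1# * 𝓔 m (map (q *_) zs) + 𝓔 (suc m) (map (q *_) zs)
      ≈⟨ +-cong (trans (*-identityˡ (𝓔 m (map (q *_) zs))) (𝓔-scale q m zs)) (𝓔-scale q (suc m) zs) ⟩
    q ^ m * 𝓔 m zs + q ^ suc m * 𝓔 (suc m) zs ∎
    where
    zs : List ℂ
    zs = applyUpTo (q ^_) k

-- Finite sums in a commutative ring.

module Sums {c ℓ} (R : CommutativeRing c ℓ) where
  open CommutativeRing R
  open Algebra.Properties.Semiring.Mult semiring using (×-homo-+; ×-cong) renaming (_×_ to _·_)
  open IntegerCoefficients R using (solve; _:+_; _:*_; _:=_)
  open import Relation.Binary.Reasoning.Setoid setoid

  ∑ : ℕ → (ℕ → Carrier) → Carrier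
  ∑ zero    f = 0#
  ∑ (suc n) f = ∑ n f + f n

  ∑-cong : ∀ n {f g} → (∀ i → i ℕ.< n → f i ≈ g i) → ∑ n f ≈ ∑ n g
  ∑-cong zero    f≈g = refl
  ∑-cong (suc n) f≈g =
    +-cong (∑-cong n (λ i i<n → f≈g i (ℕ.m<n⇒m<1+n i<n))) (f≈g n (ℕ.n<1+n n))

  ∑-distrib-+ : ∀ n f g → ∑ n (λ i → f i + g i) ≈ ∑ n f + ∑ n g
  ∑-distrib-+ zero    f g = sym (+-identityʳ 0#)
  ∑-distrib-+ (suc n) f g = trans (+-congʳ (∑-distrib-+ n f g))
    (solve 4 (λ s t x y → (s :+ t) :+ (x :+ y) := (s :+ x) :+ (t :+ y)) refl _ _ _ _)

  *-distribˡ-∑ : ∀ n x f → x * ∑ n f ≈ ∑ n (λ i → x * f i)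
  *-distribˡ-∑ zero    x f = zeroʳ x
  *-distribˡ-∑ (suc n) x f = trans (distribˡ x _ _) (+-congʳ (*-distribˡ-∑ n x f))

  *-distribʳ-∑ : ∀ n x f → ∑ n f * x ≈ ∑ n (λ i → f i * x)
  *-distribʳ-∑ zero    x f = zeroˡ x
  *-distribʳ-∑ (suc n) x f = trans (distribʳ x _ _) (+-congʳ (*-distribʳ-∑ n x f))

  ∑-+ : ∀ m n f → ∑ (m ℕ.+ n) f ≈ ∑ m f + ∑ n (λ i → f (m ℕ.+ i))
  ∑-+ m zero    f rewrite ℕ.+-identityʳ m = sym (+-identityʳ _)
  ∑-+ m (suc n) f rewrite ℕ.+-suc m n = trans (+-congʳ (∑-+ m n f)) (+-assoc _ _ _)

  ∑-suc : ∀ n f → ∑ (suc n) f ≈ f 0 + ∑ n (λ i → f (suc i))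
  ∑-suc n f = trans (∑-+ 1 n f) (+-congʳ (+-identityˡ (f 0)))

  -- Cauchy products and formal exponential series.

  infixl 7 _⊛_
  _⊛_ : (ℕ → Carrier) → (ℕ → Carrier) → ℕ → Carrier
  (a ⊛ b) k = ∑ (suc k) (λ i → a i * b (k ∸ i))

  -- The sum of a i * b j over i + j < n, arranged by rows.
  triangle : ℕ → (ℕ → Carrier) → (ℕ → Carrier) → Carrier
  triangle n a b = ∑ n (λ i → a i * ∑ (n ∸ i) b)

  -- The sum of a i * b j over the rest of the square: i, j < n with n ≤ i + j.
  excess : ℕ → (ℕ → Carrier) → (ℕ → Carrier) → Carrier
  excess n a b = ∑ n (λ i → a i * ∑ i (λ j → b (n ∸ i ℕ.+ j)))

  ∑*∑ : ∀ n a b → ∑ n a * ∑ n b ≈ triangle n a b + excess n a b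
  ∑*∑ n a b = begin
    ∑ n a * ∑ n b                ≈⟨ *-distribʳ-∑ n (∑ n b) a ⟩
    ∑ n (λ i → a i * ∑ n b)      ≈⟨ ∑-cong n split ⟩
    ∑ n (λ i → a i * ∑ (n ∸ i) b + a i * ∑ i (λ j → b (n ∸ i ℕ.+ j))) ≈⟨ ∑-distrib-+ n _ _ ⟩
    triangle n a b + excess n a b ∎
    where
    split : ∀ i → i ℕ.< n → a i * ∑ n b ≈ a i * ∑ (n ∸ i) b + a i * ∑ i (λ j → b (n ∸ i ℕ.+ j))
    split i i<n = trans
      (*-congˡ (trans (reflexive (≡.cong (λ p → ∑ p b) (≡.sym (ℕ.m∸n+n≡m (ℕ.<⇒≤ i<n))))) (∑-+ (n ∸ i) i b)))
      (distribˡ _ _ _)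

  -- Raising `n` by one lengthens each row by one entry; together the new entries form the
  -- antidiagonal i + j = n, which is the Cauchy product at `n`.
  triangle≈∑⊛ : ∀ n a b → triangle n a b ≈ ∑ n (a ⊛ b)
  triangle≈∑⊛ zero    a b = refl
  triangle≈∑⊛ (suc n) a b = begin
    triangle (suc n) a b
      ≈⟨ ∑-cong (suc n) (λ i i<1+n → trans (reflexive (≡.cong (λ p → a i * ∑ p b) (ℕ.+-∸-assoc 1 (ℕ.≤-pred i<1+n))))
                                            (distribˡ _ _ _)) ⟩
    ∑ (suc n) (λ i → a i * ∑ (n ∸ i) b + a i * b (n ∸ i))
      ≈⟨ ∑-distrib-+ (suc n) _ _ ⟩
    (triangle n a b + a n * ∑ (n ∸ n) b) + (a ⊛ b) n
      -- In the old triangle the row i = n has length n - n = 0 and contributes nothing.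
      ≈⟨ +-congʳ (+-cong (triangle≈∑⊛ n a b) (trans (reflexive (≡.cong (λ p → a n * ∑ p b) (ℕ.n∸n≡0 n))) (zeroʳ _))) ⟩
    (∑ n (a ⊛ b) + 0#) + (a ⊛ b) n
      ≈⟨ +-congʳ (+-identityʳ _) ⟩
    ∑ (suc n) (a ⊛ b) ∎

  -- The coefficients of a formal solution of u′ = z u with u(0) = 1.
  record Exponential (z : Carrier) (u : ℕ → Carrier) : Set ℓ where
    field
      at-zero : u 0 ≈ 1#
      at-suc  : ∀ k → (suc k · 1#) * u (suc k) ≈ z * u k

  open Exponential public

  -- The Leibniz rule on coefficients: k + 1 is split as i + (k + 1 - i). The first part lets the
  -- recurrence of `a` apply and vanishes at i = 0; the second does the same for `b` and vanishes at
  -- i = k + 1.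
  exponential-⊛ : ∀ {z w a b} → Exponential z a → Exponential w b → Exponential (z + w) (a ⊛ b)
  exponential-⊛ {z} {w} {a} {b} A B = record
    { at-zero = trans (+-identityˡ _) (trans (*-cong (at-zero A) (at-zero B)) (*-identityˡ 1#))
    ; at-suc  = λ k → begin
        (suc k · 1#) * ∑ (2 ℕ.+ k) (λ i → a i * b (suc k ∸ i))
          ≈⟨ *-distribˡ-∑ (2 ℕ.+ k) _ _ ⟩
        ∑ (2 ℕ.+ k) (λ i → (suc k · 1#) * (a i * b (suc k ∸ i)))
          ≈⟨ ∑-cong (2 ℕ.+ k) (leibniz k) ⟩
        ∑ (2 ℕ.+ k) (λ i → (i · 1#) * a i * b (suc k ∸ i) + a i * ((suc k ∸ i) · 1# * b (suc k ∸ i)))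
          ≈⟨ ∑-distrib-+ (2 ℕ.+ k) _ _ ⟩
        ∑ (2 ℕ.+ k) (λ i → (i · 1#) * a i * b (suc k ∸ i))
          + ∑ (2 ℕ.+ k) (λ i → a i * ((suc k ∸ i) · 1# * b (suc k ∸ i)))
          ≈⟨ +-cong (left k) (right k) ⟩
        z * (a ⊛ b) k + w * (a ⊛ b) k ≈⟨ distribʳ _ _ _ ⟨
        (z + w) * (a ⊛ b) k ∎
    }
    where
    leibniz : ∀ k i → i ℕ.< 2 ℕ.+ k →
      (suc k · 1#) * (a i * b (suc k ∸ i))
        ≈ (i · 1#) * a i * b (suc k ∸ i) + a i * ((suc k ∸ i) · 1# * b (suc k ∸ i))
    leibniz k i i≤k+1 = begin
      (suc k · 1#) * (a i * b (suc k ∸ i))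
        ≈⟨ *-congʳ (×-cong (≡.sym (ℕ.m+[n∸m]≡n (ℕ.≤-pred i≤k+1))) refl) ⟩
      ((i ℕ.+ (suc k ∸ i)) · 1#) * (a i * b (suc k ∸ i))
        ≈⟨ *-congʳ (×-homo-+ 1# i (suc k ∸ i)) ⟩
      (i · 1# + (suc k ∸ i) · 1#) * (a i * b (suc k ∸ i))
        ≈⟨ solve 4 (λ x y s t → (x :+ y) :* (s :* t) := x :* s :* t :+ s :* (y :* t)) refl _ _ _ _ ⟩
      (i · 1#) * a i * b (suc k ∸ i) + a i * ((suc k ∸ i) · 1# * b (suc k ∸ i)) ∎

    left : ∀ k → ∑ (2 ℕ.+ k) (λ i → (i · 1#) * a i * b (suc k ∸ i)) ≈ z * (a ⊛ b) k
    left k = begin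
      ∑ (2 ℕ.+ k) (λ i → (i · 1#) * a i * b (suc k ∸ i)) ≈⟨ ∑-suc (suc k) _ ⟩
      0# * a 0 * b (suc k) + ∑ (suc k) (λ i → (suc i · 1#) * a (suc i) * b (k ∸ i))
        ≈⟨ +-cong (trans (*-congʳ (zeroˡ _)) (zeroˡ _))
                  (∑-cong (suc k) (λ i _ → trans (*-congʳ (at-suc A i)) (*-assoc _ _ _))) ⟩
      0# + ∑ (suc k) (λ i → z * (a i * b (k ∸ i))) ≈⟨ +-identityˡ _ ⟩
      ∑ (suc k) (λ i → z * (a i * b (k ∸ i))) ≈⟨ *-distribˡ-∑ (suc k) z _ ⟨
      z * (a ⊛ b) k ∎

    right : ∀ k → ∑ (2 ℕ.+ k) (λ i → a i * ((suc k ∸ i) · 1# * b (suc k ∸ i))) ≈ w * (a ⊛ b) k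
    right k = begin
      ∑ (suc k) (λ i → a i * ((suc k ∸ i) · 1# * b (suc k ∸ i))) + a (suc k) * ((k ∸ k) · 1# * b (k ∸ k))
        ≈⟨ +-cong (∑-cong (suc k) step)
             (trans (*-congˡ (trans (*-congʳ (×-cong (ℕ.n∸n≡0 k) refl)) (zeroˡ _))) (zeroʳ _)) ⟩
      ∑ (suc k) (λ i → w * (a i * b (k ∸ i))) + 0# ≈⟨ +-identityʳ _ ⟩
      ∑ (suc k) (λ i → w * (a i * b (k ∸ i))) ≈⟨ *-distribˡ-∑ (suc k) w _ ⟨
      w * (a ⊛ b) k ∎
      where
      step : ∀ i → i ℕ.< suc k → a i * ((suc k ∸ i) · 1# * b (suc k ∸ i)) ≈ w * (a i * b (k ∸ i))
      step i i≤k = begin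
        a i * ((suc k ∸ i) · 1# * b (suc k ∸ i))
          ≡⟨ ≡.cong (λ p → a i * (p · 1# * b p)) (ℕ.+-∸-assoc 1 (ℕ.≤-pred i≤k)) ⟩
        a i * (suc (k ∸ i) · 1# * b (suc (k ∸ i))) ≈⟨ *-congˡ (at-suc B (k ∸ i)) ⟩
        a i * (w * b (k ∸ i)) ≈⟨ solve 3 (λ x y t → x :* (y :* t) := y :* (x :* t)) refl _ _ _ ⟩
        w * (a i * b (k ∸ i)) ∎

  module _ (invertible : ∀ k → Algebra.Definitions.Invertible _≈_ 1# _*_ (suc k · 1#)) where
    open GaussianPascal R using (*-cancelˡ-invertible)

    exponential-unique : ∀ {z u v} → Exponential z u → Exponential z v → ∀ k → u k ≈ v k
    exponential-unique U V zero    = trans (at-zero U) (sym (at-zero V))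
    exponential-unique U V (suc k) = *-cancelˡ-invertible (invertible k)
      (trans (at-suc U k) (trans (*-congˡ (exponential-unique U V k)) (sym (at-suc V k))))

-- The weak order and absolute bounds in a constructive ordered field.

module Order {c ℓ₁ ℓ₂} (R : RealField c ℓ₁ ℓ₂) where
  open RealField R
  open OrderProperties R
  open Algebra.Apartness.Properties.HeytingCommutativeRing heytingCommutativeRing
    using (x-0≈x; invertibleˡ⇒#)
  open Algebra.Properties.Ring (CommutativeRing.ring commutativeRing) using (-0#≈0#; -‿involutive)
  open IntegerCoefficients commutativeRing using (solve; _:+_; _:*_; _:-_; :-_; _:=_)

  infix 4 _≤_
  -- Constructively the disjunction of `x < y` and `x ≈ y` would be too strong. The negation can be
  -- proved by contradiction, with cotransitivity of `_<_` in place of trichotomy.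
  _≤_ : Carrier → Carrier → Set ℓ₂
  x ≤ y = ¬ y < x

  <⇒≤ : ∀ {x y} → x < y → x ≤ y
  <⇒≤ x<y y<x = <-irrefl refl (<-trans x<y y<x)

  ≤-reflexive : ∀ {x y} → x ≈ y → x ≤ y
  ≤-reflexive x≈y y<x = <-irrefl (sym x≈y) y<x

  ≤-resp : ∀ {w x y z} → w ≈ x → y ≈ z → w ≤ y → x ≤ z
  ≤-resp w≈x y≈z w≤y z<x = w≤y (<-respˡ (sym y≈z) (<-respʳ (sym w≈x) z<x))

  ≤-<-trans : ∀ {x y z} → x ≤ y → y < z → x < z
  ≤-<-trans {x} x≤y y<z with cotransitive y<z x
  ... | inj₁ y<x = contradiction y<x x≤y
  ... | inj₂ x<z = x<z

  ≤-trans : ∀ {x y z} → x ≤ y → y ≤ z → x ≤ z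
  ≤-trans x≤y y≤z z<x = x≤y (≤-<-trans y≤z z<x)

  -- If x + z < w + y, then comparing `x + y` with both ends shows z < y or x < w.
  +-mono-≤ : ∀ {w x y z} → w ≤ x → y ≤ z → w + y ≤ x + z
  +-mono-≤ {w} {x} {y} {z} w≤x y≤z xz<wy with cotransitive xz<wy (x + y)
  ... | inj₁ p = y≤z (<-respˡ (cancel x z) (<-respʳ (cancel x y) (+-monoˡ-< (- x) p)))
    where
    cancel : ∀ x z → x + z + - x ≈ z
    cancel = solve 2 (λ x z → x :+ z :- x := z) refl
  ... | inj₂ p = w≤x (<-respˡ (cancel x y) (<-respʳ (cancel w y) (+-monoˡ-< (- y) p)))
    where
    cancel : ∀ x y → x + y + - y ≈ x
    cancel = solve 2 (λ x y → x :+ y :- y := x) refl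

  +-monoʳ-≤ : ∀ x {y z} → y ≤ z → x + y ≤ x + z
  +-monoʳ-≤ x = +-mono-≤ (≤-reflexive refl)

  x≤y⇒0≤y-x : ∀ {x y} → x ≤ y → 0# ≤ y - x
  x≤y⇒0≤y-x x≤y = ≤-resp (-‿inverseʳ _) refl (+-mono-≤ x≤y (≤-reflexive refl))

  0≤y-x⇒x≤y : ∀ {x y} → 0# ≤ y - x → x ≤ y
  0≤y-x⇒x≤y {x} {y} 0≤y-x = ≤-resp (+-identityˡ x)
    (solve 2 (λ x y → (y :- x) :+ x := y) refl x y) (+-mono-≤ 0≤y-x (≤-reflexive refl))

  0≤x∧x#0⇒0<x : ∀ {x} → 0# ≤ x → x # 0# → 0# < x
  0≤x∧x#0⇒0<x 0≤x x#0 with Equivalence.to #⇔<⊎> x#0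
  ... | inj₁ x<0 = contradiction x<0 0≤x
  ... | inj₂ 0<x = 0<x

  -- A negative product would be invertible, so both factors would be apart from 0 and hence
  -- positive, and their product would be positive as well.
  *-nonNeg : ∀ {x y} → 0# ≤ x → 0# ≤ y → 0# ≤ x * y
  *-nonNeg {x} {y} 0≤x 0≤y xy<0 = <⇒≤ xy<0 (*-pos (0≤x∧x#0⇒0<x 0≤x x#0) (0≤x∧x#0⇒0<x 0≤y y#0))
    where
    inverse : Algebra.Definitions.Invertible _≈_ 1# _*_ (x * y - 0#)
    inverse = #⇒invertible (Equivalence.from #⇔<⊎> (inj₁ xy<0))
    u : Carrier
    u = proj₁ inverse
    uxy≈1 : u * (x * y) ≈ 1#
    uxy≈1 = trans (*-congˡ (sym (x-0≈x _))) (proj₁ (proj₂ inverse))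
    x#0 : x # 0#
    x#0 = invertibleˡ⇒# (u * y , trans (*-congˡ (x-0≈x x))
      (trans (solve 3 (λ u x y → u :* y :* x := u :* (x :* y)) refl u x y) uxy≈1))
    y#0 : y # 0#
    y#0 = invertibleˡ⇒# (u * x , trans (*-congˡ (x-0≈x y)) (trans (*-assoc u x y) uxy≈1))

  *-monoˡ-≤ : ∀ {x y z} → 0# ≤ z → x ≤ y → z * x ≤ z * y
  *-monoˡ-≤ {x} {y} {z} 0≤z x≤y = 0≤y-x⇒x≤y (≤-resp refl
    (solve 3 (λ x y z → z :* (y :- x) := z :* y :- z :* x) refl x y z) (*-nonNeg 0≤z (x≤y⇒0≤y-x x≤y)))

  0≤x+x⇒0≤x : ∀ {x} → 0# ≤ x + x → 0# ≤ x
  0≤x+x⇒0≤x 0≤x+x x<0 = 0≤x+x (<-respʳ (+-identityˡ 0#) (+-mono-< x<0 x<0))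

  infix 4 ∣_∣≤_
  -- The weak counterpart of `_◁_`: two one-sided bounds replace an absolute value.
  ∣_∣≤_ : Carrier → Carrier → Set ℓ₂
  ∣ x ∣≤ b = x ≤ b × - x ≤ b

  ◁⇒∣∣≤ : ∀ {x b} → x ◁ b → ∣ x ∣≤ b
  ◁⇒∣∣≤ (p , q) = <⇒≤ p , <⇒≤ q

  ∣∣≤-◁-trans : ∀ {x b d} → ∣ x ∣≤ b → b ◁ d → x ◁ d
  ∣∣≤-◁-trans (p , q) (b<d , _) = ≤-<-trans p b<d , ≤-<-trans q b<d

  ∣∣≤-resp : ∀ {x y a b} → x ≈ y → a ≈ b → ∣ x ∣≤ a → ∣ y ∣≤ b
  ∣∣≤-resp x≈y a≈b (p , q) = ≤-resp x≈y a≈b p , ≤-resp (-‿cong x≈y) a≈b q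

  ∣∣≤-weaken : ∀ {x a b} → a ≤ b → ∣ x ∣≤ a → ∣ x ∣≤ b
  ∣∣≤-weaken a≤b (p , q) = ≤-trans p a≤b , ≤-trans q a≤b

  ∣0∣≤ : ∀ {b} → 0# ≤ b → ∣ 0# ∣≤ b
  ∣0∣≤ 0≤b = 0≤b , ≤-resp (sym -0#≈0#) refl 0≤b

  ∣∣≤⇒0≤ : ∀ {x b} → ∣ x ∣≤ b → 0# ≤ b
  ∣∣≤⇒0≤ {x} (p , q) = 0≤x+x⇒0≤x (≤-resp (-‿inverseʳ x) refl (+-mono-≤ p q))

  0≤x⇒∣x∣≤x : ∀ {x} → 0# ≤ x → ∣ x ∣≤ x
  0≤x⇒∣x∣≤x {x} 0≤x = ≤-reflexive refl , 0≤y-x⇒x≤y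
    (≤-resp refl (solve 1 (λ x → x :+ x := x :- :- x) refl x)
      (≤-resp (+-identityˡ 0#) refl (+-mono-≤ 0≤x 0≤x)))

  ∣neg∣≤ : ∀ {x b} → ∣ x ∣≤ b → ∣ - x ∣≤ b
  ∣neg∣≤ (p , q) = q , ≤-resp (sym (-‿involutive _)) refl p

  ∣+∣≤ : ∀ {x y a b} → ∣ x ∣≤ a → ∣ y ∣≤ b → ∣ x + y ∣≤ a + b
  ∣+∣≤ {x} {y} (p , q) (p′ , q′) = +-mono-≤ p p′ ,
    ≤-resp (solve 2 (λ x y → (:- x) :+ (:- y) := :- (x :+ y)) refl x y) refl (+-mono-≤ q q′)

  -- The upper bound rests on (a - x)(b + y) + (a + x)(b - y) = 2 (ab - xy), whose left side is a
  -- sum of products of nonnegative factors; the lower bound is the upper one for `- x`.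
  ∣*∣≤ : ∀ {x y a b} → ∣ x ∣≤ a → ∣ y ∣≤ b → ∣ x * y ∣≤ a * b
  ∣*∣≤ {x} {y} X Y = upper X Y ,
    ≤-resp (solve 2 (λ x y → (:- x) :* y := :- (x :* y)) refl x y) refl (upper (∣neg∣≤ X) Y)
    where
    upper : ∀ {x y a b} → ∣ x ∣≤ a → ∣ y ∣≤ b → x * y ≤ a * b
    upper {x} {y} {a} {b} (p , q) (p′ , q′) = 0≤y-x⇒x≤y (0≤x+x⇒0≤x (≤-resp (+-identityˡ 0#)
      (solve 4 (λ x y a b → (a :- x) :* (b :- (:- y)) :+ (a :- (:- x)) :* (b :- y)
                         := (a :* b :- x :* y) :+ (a :* b :- x :* y)) refl x y a b)
      (+-mono-≤ (*-nonNeg (x≤y⇒0≤y-x p) (x≤y⇒0≤y-x q′)) (*-nonNeg (x≤y⇒0≤y-x q) (x≤y⇒0≤y-x p′)))))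

  -- Null sequences and eventually bounded sequences.

  Null : (ℕ → Carrier) → Set (c ⊔ ℓ₂)
  Null s = ∀ ε → 0# < ε → ∃[ N ] ∀ p → N ℕ.≤ p → s p ◁ ε

  -- Only an eventual bound is asked for, and by a natural number, so that `÷2^-small` applies to
  -- it.
  Bounded : (ℕ → Carrier) → Set ℓ₂
  Bounded s = ∃[ B ] ∃[ N ] ∀ p → N ℕ.≤ p → s p ◁ fromℕ B

  null-resp : ∀ {s t} → (∀ p → s p ≈ t p) → Null s → Null t
  null-resp s≈t S ε 0<ε with S ε 0<ε
  ... | N , s◁ = N , λ p N≤p → ◁-resp (s≈t p) refl (s◁ p N≤p)

  null-squeeze : ∀ {s t} → (∀ p → ∣ s p ∣≤ t p) → Null t → Null s
  null-squeeze s≤t T ε 0<ε with T ε 0<ε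
  ... | N , t◁ = N , λ p N≤p → ∣∣≤-◁-trans (s≤t p) (t◁ p N≤p)

  null-neg : ∀ {s} → Null s → Null (λ p → - s p)
  null-neg S ε 0<ε with S ε 0<ε
  ... | N , s◁ = N , λ p N≤p → ◁-neg (s◁ p N≤p)

  null-+ : ∀ {s t} → Null s → Null t → Null (λ p → s p + t p)
  null-+ {s} {t} S T ε 0<ε =
    let j , 1÷2ʲ<ε = ÷2^-small 1 0<ε
        M , s◁     = S (1 ÷2^ suc j) (0<1÷2^ (suc j))
        N , t◁     = T (1 ÷2^ suc j) (0<1÷2^ (suc j))
    in M ℕ.+ N , λ p M+N≤p → ◁-weaken 1÷2ʲ<ε (◁-resp refl (÷2^-halves 1 j)
      (◁-+ (s◁ p (ℕ.≤-trans (ℕ.m≤m+n M N) M+N≤p)) (t◁ p (ℕ.≤-trans (ℕ.m≤n+m N M) M+N≤p))))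
    where
    0<1÷2^ : ∀ j → 0# < 1 ÷2^ j
    0<1÷2^ j = *-pos (fromℕ-pos 0) (recip-pos (2 ℕ.^ j) {{ℕ.m^n≢0 2 j}})

  null-* : ∀ {s t} → Null s → Bounded t → Null (λ p → s p * t p)
  null-* {s} {t} S (B , M , t◁) ε 0<ε =
    -- The null factor is pushed below 1 / 2ʲ, where B / 2ʲ < ε, so no division by `B` is needed.
    let j , B÷2ʲ<ε = ÷2^-small B 0<ε
        N , s◁     = S (recip (2 ℕ.^ j) {{ℕ.m^n≢0 2 j}}) (recip-pos (2 ℕ.^ j) {{ℕ.m^n≢0 2 j}})
    in M ℕ.+ N , λ p M+N≤p → ◁-weaken B÷2ʲ<ε (◁-resp refl (*-comm _ _)
      (◁-* (s◁ p (ℕ.≤-trans (ℕ.m≤n+m N M) M+N≤p)) (t◁ p (ℕ.≤-trans (ℕ.m≤m+n M N) M+N≤p))))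

  -- By tightness of apartness it suffices to refute `x # 0#`; the positive one of `x` and `- x`,
  -- taken as ε, would have to be smaller than itself.
  null-const : ∀ {x} → Null (λ _ → x) → x ≈ 0#
  null-const {x} X = proj₁ (tight x 0#) λ x#0 → absurd x#0
    where
    absurd : ¬ x # 0#
    absurd x#0 with Equivalence.to #⇔<⊎> x#0
    ... | inj₂ 0<x = let N , x◁ = X x 0<x in <-irrefl refl (proj₁ (x◁ N ℕ.≤-refl))
    ... | inj₁ x<0 = let N , x◁ = X (- x) 0<-x in <-irrefl refl (proj₂ (x◁ N ℕ.≤-refl))
      where
      0<-x : 0# < - x
      0<-x = <-respʳ (+-identityˡ _) (x<y⇒0<y-x x<0)

  null⇒bounded : ∀ {s} → Null s → Bounded s
  null⇒bounded S = 1 , S (fromℕ 1) (fromℕ-pos 0)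

  bounded-resp : ∀ {s t} → (∀ p → s p ≈ t p) → Bounded s → Bounded t
  bounded-resp s≈t (B , N , s◁) = B , N , λ p N≤p → ◁-resp (s≈t p) refl (s◁ p N≤p)

  ∃-bound : ∀ x → ∃[ B ] x ◁ fromℕ B
  ∃-bound x = let a , x<a  = archimedean x
                  b , -x<b = archimedean (- x)
              in suc (a ℕ.+ b) , <-trans x<a (fromℕ-mono-< (ℕ.s≤s (ℕ.m≤m+n a b)))
                               , <-trans -x<b (fromℕ-mono-< (ℕ.s≤s (ℕ.m≤n+m b a)))

  bounded-const : ∀ x → Bounded (λ _ → x)
  bounded-const x = let B , x◁B = ∃-bound x in B , 0 , λ _ _ → x◁B

  bounded-+ : ∀ {s t} → Bounded s → Bounded t → Bounded (λ p → s p + t p)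
  bounded-+ (A , M , s◁) (B , N , t◁) = A ℕ.+ B , M ℕ.+ N , λ p M+N≤p →
    ◁-resp refl (sym (fromℕ-homo-+ A B))
      (◁-+ (s◁ p (ℕ.≤-trans (ℕ.m≤m+n M N) M+N≤p)) (t◁ p (ℕ.≤-trans (ℕ.m≤n+m N M) M+N≤p)))

  ⟶⇒null : ∀ {s l} → s ⟶ l → Null (λ p → s p - l)
  ⟶⇒null {s} {l} s⟶l ε 0<ε with s⟶l ε 0<ε
  ... | N , close = N , λ p N≤p → proj₁ (close p N≤p) ,
    <-respˡ (solve 2 (λ s l → l :- s := :- (s :- l)) refl (s p) l) (proj₂ (close p N≤p))

  null-difference⇒bounded : ∀ {s l} → Null (λ p → s p - l) → Bounded s
  null-difference⇒bounded {s} {l} S = bounded-resp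
    (λ p → solve 2 (λ s l → (s :- l) :+ l := s) refl (s p) l)
    (bounded-+ (null⇒bounded S) (bounded-const l))

  cauchy⇒bounded : ∀ {s} → Cauchy s → Bounded s
  cauchy⇒bounded {s} C = null-difference⇒bounded (⟶⇒null (proj₂ (complete s C)))

  -- Beyond a suitable index both `p` and `f p` pass the Cauchy threshold, because `f` tends to
  -- infinity.
  cauchy⇒null : ∀ {s} → Cauchy s → (f : ℕ → ℕ) → (∀ N → ∃[ M ] ∀ p → M ℕ.≤ p → N ℕ.≤ f p) →
                Null (λ p → s p - s (f p))
  cauchy⇒null {s} C f f-large ε 0<ε with C ε 0<ε
  ... | N , close with f-large N
  ...   | M , N≤f = M ℕ.+ N , λ p M+N≤p →
    let N≤p  = ℕ.≤-trans (ℕ.m≤n+m N M) M+N≤p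
        N≤fp = N≤f p (ℕ.≤-trans (ℕ.m≤m+n M N) M+N≤p)
    in close p (f p) N≤p N≤fp ,
       <-respˡ (solve 2 (λ s l → l :- s := :- (s :- l)) refl (s p) (s (f p))) (close (f p) p N≤fp N≤p)

-- Sums of nonnegative reals and the decay of the excess.

module RealSums {c ℓ₁ ℓ₂} (R : RealField c ℓ₁ ℓ₂) where
  open RealField R
  open Order R
  open Sums commutativeRing
  open IntegerCoefficients commutativeRing using (solve; _:+_; _:*_; _:-_; :-_; _:=_)

  ∑-mono : ∀ n {f g} → (∀ i → i ℕ.< n → f i ≤ g i) → ∑ n f ≤ ∑ n g
  ∑-mono zero    f≤g = ≤-reflexive refl
  ∑-mono (suc n) f≤g =
    +-mono-≤ (∑-mono n (λ i i<n → f≤g i (ℕ.m<n⇒m<1+n i<n))) (f≤g n (ℕ.n<1+n n))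

  ∑-nonNeg : ∀ n {f} → (∀ i → 0# ≤ f i) → 0# ≤ ∑ n f
  ∑-nonNeg zero    0≤f = ≤-reflexive refl
  ∑-nonNeg (suc n) 0≤f = ≤-resp (+-identityˡ 0#) refl (+-mono-≤ (∑-nonNeg n 0≤f) (0≤f n))

  ∑-≤-∑ : ∀ {m n} → m ℕ.≤ n → ∀ {f} → (∀ i → 0# ≤ f i) → ∑ m f ≤ ∑ n f
  ∑-≤-∑ {m} {n} m≤n {f} 0≤f = ≤-resp (+-identityʳ _)
    (trans (sym (∑-+ m (n ∸ m) f)) (reflexive (≡.cong (λ p → ∑ p f) (ℕ.m+[n∸m]≡n m≤n))))
    (+-monoʳ-≤ (∑ m f) (∑-nonNeg (n ∸ m) (λ i → 0≤f (m ℕ.+ i))))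

  -- The triangle i + j < n contains the square i , j < h.
  excess-≤ : ∀ {h n} → h ℕ.+ h ℕ.≤ n → ∀ {a} → (∀ i → 0# ≤ a i) →
             excess n a a ≤ ∑ n a * ∑ n a - ∑ h a * ∑ h a
  excess-≤ {h} {n} h+h≤n {a} 0≤a = ≤-resp
    (trans (+-congʳ (∑*∑ n a a)) (solve 2 (λ x y → (x :+ y) :- x := y) refl _ _)) refl
    (+-monoʳ-≤ (∑ n a * ∑ n a) (-‿anti-mono square≤triangle))
    where
    -‿anti-mono : ∀ {x y} → x ≤ y → - y ≤ - x
    -‿anti-mono {x} {y} x≤y = 0≤y-x⇒x≤y
      (≤-resp refl (solve 2 (λ x y → y :- x := (:- x) :- (:- y)) refl x y) (x≤y⇒0≤y-x x≤y))
    square≤triangle : ∑ h a * ∑ h a ≤ triangle n a a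
    square≤triangle = ≤-trans
      (≤-resp (sym (*-distribʳ-∑ h (∑ h a) a)) refl
        (∑-mono h (λ i i<h → *-monoˡ-≤ (0≤a i)
          (∑-≤-∑ (ℕ.≤-trans (ℕ.m+n≤o⇒m≤o∸n h h+h≤n) (ℕ.∸-monoʳ-≤ n (ℕ.<⇒≤ i<h))) 0≤a))))
      (∑-≤-∑ (ℕ.m+n≤o⇒m≤o h h+h≤n) (λ i → *-nonNeg (0≤a i) (∑-nonNeg (n ∸ i) 0≤a)))

  -- With h = ⌊ n /2⌋ the excess is at most A(n)² - A(h)² for the partial sums A, and this tends to
  -- 0 because A is Cauchy.
  null-excess : ∀ {a} → (∀ i → 0# ≤ a i) → Cauchy (λ n → ∑ n a) →
                ∃[ t ] (Null t × (∀ n → excess n a a ≤ t n))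
  null-excess {a} 0≤a C = (λ n → A n * A n - A ⌊ n /2⌋ * A ⌊ n /2⌋) , null , λ n → excess-≤ {⌊ n /2⌋} (half+half n) 0≤a
    where
    A : ℕ → Carrier
    A n = ∑ n a
    half+half : ∀ n → ⌊ n /2⌋ ℕ.+ ⌊ n /2⌋ ℕ.≤ n
    half+half n = ℕ.≤-trans (ℕ.+-monoʳ-≤ ⌊ n /2⌋ (ℕ.⌊n/2⌋≤⌈n/2⌉ n)) (ℕ.≤-reflexive (ℕ.⌊n/2⌋+⌈n/2⌉≡n n))
    half-large : ∀ N → ∃[ M ] ∀ n → M ℕ.≤ n → N ℕ.≤ ⌊ n /2⌋
    half-large N = N ℕ.+ N , λ n 2N≤n →
      ℕ.≤-trans (ℕ.≤-reflexive (ℕ.n≡⌊n+n/2⌋ N)) (ℕ.⌊n/2⌋-mono 2N≤n)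
    tail : Null (λ n → A n - A ⌊ n /2⌋)
    tail = cauchy⇒null C ⌊_/2⌋ half-large
    null : Null (λ n → A n * A n - A ⌊ n /2⌋ * A ⌊ n /2⌋)
    null = null-resp
      -- The difference of squares is the null factor x - y times x + y. Writing x + y as 2x - (x -
      -- y) makes its boundedness follow from that of A and of the null factor.
      (λ n → solve 2 (λ x y → (x :- y) :* ((x :+ x) :+ (:- (x :- y))) := x :* x :- y :* y) refl (A n) (A ⌊ n /2⌋))
      (null-* tail (bounded-+ (bounded-+ (cauchy⇒bounded C) (cauchy⇒bounded C)) (null⇒bounded (null-neg tail))))

-- Coordinatewise bounds and limits of complex sequences.

module ComplexExponential {c ℓ₁ ℓ₂} (R : RealField c ℓ₁ ℓ₂) where
  private
    module ℝ where
      open RealField R public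
      open Order R public
      open OrderProperties R public
      open Sums commutativeRing public
      open RealSums R public
  open Complex R using (ℂ; _+i_; re; im; expTerm; expSum; exp; expSum-re-cauchy; expSum-im-cauchy)
  open ComplexRing R using (commutativeRing)
  open CommutativeRing commutativeRing
  open Sums commutativeRing
  open Algebra.Properties.Group +-group using (x∙y⁻¹≈ε⇒x≈y; x≈y⇒x∙y⁻¹≈ε)
  open Algebra.Properties.Semiring.Exp semiring using (_^_; ^-congˡ)
  open Algebra.Properties.Semiring.Mult semiring using () renaming (_×_ to _·_)
  open IntegerCoefficients commutativeRing using (solve; _:+_; _:*_; _:-_; :-_; _:=_)
  private module ℝ-Solver = IntegerCoefficients ℝ.commutativeRing
  open import Relation.Binary.Reasoning.Setoid setoid

  infix 4 _≼_
  -- Bounding the coordinates instead of the modulus avoids square roots, at the price of a factor 2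
  -- in each product.
  _≼_ : ℂ → ℝ.Carrier → Set ℓ₂
  z ≼ b = ℝ.∣ re z ∣≤ b × ℝ.∣ im z ∣≤ b

  ≼-* : ∀ {z w a b} → z ≼ a → w ≼ b → z * w ≼ a ℝ.* b ℝ.+ a ℝ.* b
  ≼-* (p , q) (p′ , q′) =
      ℝ.∣+∣≤ (ℝ.∣*∣≤ p p′) (ℝ.∣neg∣≤ (ℝ.∣*∣≤ q q′))
    , ℝ.∣+∣≤ (ℝ.∣*∣≤ p q′) (ℝ.∣*∣≤ q p′)

  ≼-∑ : ∀ n {f g} → (∀ i → f i ≼ g i) → ∑ n f ≼ ℝ.∑ n g
  ≼-∑ zero    f≼g = ℝ.∣0∣≤ (ℝ.≤-reflexive ℝ.refl) , ℝ.∣0∣≤ (ℝ.≤-reflexive ℝ.refl)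
  ≼-∑ (suc n) f≼g =
      ℝ.∣+∣≤ (proj₁ (≼-∑ n f≼g)) (proj₁ (f≼g n))
    , ℝ.∣+∣≤ (proj₂ (≼-∑ n f≼g)) (proj₂ (f≼g n))

  excess-≼ : ∀ n {a b α β} → (∀ i → a i ≼ α i) → (∀ i → b i ≼ β i) →
             excess n a b ≼ ℝ.excess n α β ℝ.+ ℝ.excess n α β
  excess-≼ n {a} {b} {α} {β} a≼α b≼β =
      ℝ.∣∣≤-resp ℝ.refl (ℝ.∑-distrib-+ n _ _) (proj₁ bound)
    , ℝ.∣∣≤-resp ℝ.refl (ℝ.∑-distrib-+ n _ _) (proj₂ bound)
    where
    X : ℕ → ℝ.Carrier
    X i = α i ℝ.* ℝ.∑ i (λ j → β (n ∸ i ℕ.+ j))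
    bound : excess n a b ≼ ℝ.∑ n (λ i → X i ℝ.+ X i)
    bound = ≼-∑ n {λ i → a i * ∑ i (λ j → b (n ∸ i ℕ.+ j))}
              (λ i → ≼-* {a i} {∑ i (λ j → b (n ∸ i ℕ.+ j))} (a≼α i) (≼-∑ i (λ j → b≼β (n ∸ i ℕ.+ j))))

  Null : (ℕ → ℂ) → Set (c ⊔ ℓ₂)
  Null s = ℝ.Null (re ∘ s) × ℝ.Null (im ∘ s)

  Bounded : (ℕ → ℂ) → Set ℓ₂
  Bounded s = ℝ.Bounded (re ∘ s) × ℝ.Bounded (im ∘ s)

  null-resp : ∀ {s t} → (∀ p → s p ≈ t p) → Null s → Null t
  null-resp s≈t (S , S′) = ℝ.null-resp (proj₁ ∘ s≈t) S , ℝ.null-resp (proj₂ ∘ s≈t) S′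

  null-+ : ∀ {s t} → Null s → Null t → Null (λ p → s p + t p)
  null-+ (S , S′) (T , T′) = ℝ.null-+ S T , ℝ.null-+ S′ T′

  null-neg : ∀ {s} → Null s → Null (λ p → - s p)
  null-neg (S , S′) = ℝ.null-neg S , ℝ.null-neg S′

  null-* : ∀ {s t} → Null s → Bounded t → Null (λ p → s p * t p)
  null-* (S , S′) (T , T′) =
      ℝ.null-+ (ℝ.null-* S T) (ℝ.null-neg (ℝ.null-* S′ T′))
    , ℝ.null-+ (ℝ.null-* S T′) (ℝ.null-* S′ T)

  null-const : ∀ {z} → Null (λ _ → z) → z ≈ 0#
  null-const (Z , Z′) = ℝ.null-const Z , ℝ.null-const Z′

  exp-limit : ∀ z → Null (λ p → expSum z p - exp z)
  exp-limit z = ℝ.⟶⇒null (proj₂ (ℝ.complete _ (expSum-re-cauchy z)))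
              , ℝ.⟶⇒null (proj₂ (ℝ.complete _ (expSum-im-cauchy z)))

  -- Uniqueness of limits: `exp z - l` is the difference of two null sequences. The identities for
  -- `exp` below all follow by showing that the partial sums tend to the other side.
  exp-unique : ∀ z l → Null (λ p → expSum z p - l) → exp z ≈ l
  exp-unique z l S = x∙y⁻¹≈ε⇒x≈y (exp z) l (null-const {exp z - l} (null-resp
    {λ p → (expSum z p - l) + - (expSum z p - exp z)}
    (λ p → solve 3 (λ s l e → (s :- l) :+ (:- (s :- e)) := e :- l) refl (expSum z p) l (exp z))
    (null-+ {λ p → expSum z p - l} S (null-neg {λ p → expSum z p - exp z} (exp-limit z)))))

  expSum-bounded : ∀ z → Bounded (expSum z)
  expSum-bounded z = ℝ.cauchy⇒bounded (expSum-re-cauchy z) , ℝ.cauchy⇒bounded (expSum-im-cauchy z)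

  expSum≡∑ : ∀ z p → expSum z p ≡ ∑ p (expTerm z)
  expSum≡∑ z zero    = ≡.refl
  expSum≡∑ z (suc p) = ≡.cong (_+ expTerm z p) (expSum≡∑ z p)

  expSum-cong : ∀ {z w} p → (∀ k → expTerm z k ≈ expTerm w k) → expSum z p ≈ expSum w p
  expSum-cong {z} {w} zero    t≈u = refl {0#}
  expSum-cong {z} {w} (suc p) t≈u =
    +-cong {expSum z p} {expSum w p} {expTerm z p} {expTerm w p} (expSum-cong {z} {w} p t≈u) (t≈u p)

  -- `exp` is built from `complete`, which is not assumed to respect `_≈_`; uniqueness of limits
  -- yields the congruence.
  exp-cong : ∀ {z w} → z ≈ w → exp z ≈ exp w
  exp-cong {z} {w} z≈w = exp-unique z (exp w) (null-resp {λ p → expSum w p - exp w} {λ p → expSum z p - exp w}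
    (λ p → +-congʳ { - exp w } {expSum w p} {expSum z p} (expSum-cong {w} {z} p (λ k →
      ℝ.*-congˡ (proj₁ (^-congˡ k {w} {z} (sym {z} {w} z≈w))) ,
      ℝ.*-congˡ (proj₂ (^-congˡ k {w} {z} (sym {z} {w} z≈w))))))
    (exp-limit w))

  -- The terms of the series as a formal exponential.

  fromℝ : ℝ.Carrier → ℂ
  fromℝ r = r +i ℝ.0#

  fromℝ-* : ∀ r z → fromℝ r * z ≈ (r ℝ.* re z +i r ℝ.* im z)
  fromℝ-* r (x +i y) =
      ℝ.trans (ℝ.+-congˡ (ℝ.trans (ℝ.-‿cong (ℝ.zeroˡ y)) -0#≈0#)) (ℝ.+-identityʳ _)
    , ℝ.trans (ℝ.+-congˡ (ℝ.zeroˡ x)) (ℝ.+-identityʳ _)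
    where open Algebra.Properties.Ring (CommutativeRing.ring ℝ.commutativeRing) using (-0#≈0#)

  ·1#≈fromℝ : ∀ n → n · 1# ≈ fromℝ (ℝ.fromℕ n)
  ·1#≈fromℝ zero    = ℝ.refl , ℝ.refl
  ·1#≈fromℝ (suc n) = ℝ.+-congˡ (proj₁ (·1#≈fromℝ n)) , ℝ.trans (ℝ.+-identityˡ _) (proj₂ (·1#≈fromℝ n))

  ·1#-* : ∀ n z → (n · 1#) * z ≈ (ℝ.fromℕ n ℝ.* re z +i ℝ.fromℕ n ℝ.* im z)
  ·1#-* n z = trans {(n · 1#) * z} {fromℝ (ℝ.fromℕ n) * z}
    (*-congʳ {z} {n · 1#} {fromℝ (ℝ.fromℕ n)} (·1#≈fromℝ n)) (fromℝ-* (ℝ.fromℕ n) z)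

  ·1#-invertible : ∀ k → Algebra.Definitions.Invertible _≈_ 1# _*_ (suc k · 1#)
  ·1#-invertible k = r , trans {r * (suc k · 1#)} {(suc k · 1#) * r} (*-comm r (suc k · 1#)) inverse , inverse
    where
    r : ℂ
    r = fromℝ (ℝ.recip (suc k))
    inverse : (suc k · 1#) * r ≈ 1#
    inverse = trans {(suc k · 1#) * r} (·1#-* (suc k) r) (ℝ.recip-inverse (suc k) , ℝ.zeroʳ _)

  recip-! : ∀ k → ℝ.fromℕ (suc k) ℝ.* ℝ.recip (suc k !) {{suc k ℕ.!≢0}} ℝ.≈ ℝ.recip (k !) {{k ℕ.!≢0}}
  recip-! k = GaussianPascal.*-cancelˡ-invertible ℝ.commutativeRing
    (ℝ.recip (k !) , ℝ.trans (ℝ.*-comm _ _) (ℝ.recip-inverse (k !)) , ℝ.recip-inverse (k !))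
    (ℝ.trans (ℝ.sym (ℝ.*-assoc _ _ _)) (ℝ.trans
      (ℝ.*-congʳ (ℝ.trans (ℝ.sym (ℝ.fromℕ-homo-* (k !) (suc k)))
        (ℝ.reflexive (≡.cong ℝ.fromℕ (ℕ.*-comm (k !) (suc k))))))
      (ℝ.trans (ℝ.recip-inverse (suc k !)) (ℝ.sym (ℝ.recip-inverse (k !))))))
    where
    instance
      k!≢0 : NonZero (k !)
      k!≢0 = k ℕ.!≢0
      1+k!≢0 : NonZero (suc k !)
      1+k!≢0 = suc k ℕ.!≢0

  recip-1 : ℝ.recip 1 ℝ.≈ ℝ.1#
  recip-1 = ℝ.trans (ℝ.sym (ℝ.*-identityˡ _))
    (ℝ.trans (ℝ.*-congʳ (ℝ.sym (ℝ.+-identityʳ ℝ.1#))) (ℝ.recip-inverse 1))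

  expTerm≈ : ∀ z k → expTerm z k ≈ fromℝ (ℝ.recip (k !) {{k ℕ.!≢0}}) * z ^ k
  expTerm≈ z k = sym {fromℝ r * z ^ k} {expTerm z k} (fromℝ-* r (z ^ k))
    where
    r : ℝ.Carrier
    r = ℝ.recip (k !) {{k ℕ.!≢0}}

  expTerm-zero : ∀ z → expTerm z 0 ≈ 1#
  expTerm-zero z = ℝ.trans (ℝ.*-identityʳ _) recip-1 , ℝ.zeroʳ _

  expTerm-exponential : ∀ z → Exponential z (expTerm z)
  expTerm-exponential z = record
    { at-zero = expTerm-zero z
    ; at-suc  = λ k → begin
        (suc k · 1#) * expTerm z (suc k)
          ≈⟨ ·1#-* (suc k) (expTerm z (suc k)) ⟩
        (ℝ.fromℕ (suc k) ℝ.* re (expTerm z (suc k)) +i ℝ.fromℕ (suc k) ℝ.* im (expTerm z (suc k)))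
          ≈⟨ lower k (re (z ^ suc k)) , lower k (im (z ^ suc k)) ⟩
        (r k ℝ.* re (z ^ suc k) +i r k ℝ.* im (z ^ suc k))
          ≈⟨ fromℝ-* (r k) (z ^ suc k) ⟨
        fromℝ (r k) * (z * z ^ k)
          ≈⟨ solve 3 (λ x y t → x :* (y :* t) := y :* (x :* t)) refl (fromℝ (r k)) z (z ^ k) ⟩
        z * (fromℝ (r k) * z ^ k)
          ≈⟨ *-congˡ {z} {expTerm z k} {fromℝ (r k) * z ^ k} (expTerm≈ z k) ⟨
        z * expTerm z k ∎
    }
    where
    r : ℕ → ℝ.Carrier
    r k = ℝ.recip (k !) {{k ℕ.!≢0}}
    lower : ∀ k x → ℝ.fromℕ (suc k) ℝ.* (r (suc k) ℝ.* x) ℝ.≈ r k ℝ.* x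
    lower k x = ℝ.trans (ℝ.sym (ℝ.*-assoc _ _ _)) (ℝ.*-congʳ (recip-! k))

  -- The binomial theorem divided by k!, without binomial coefficients: both sides solve the
  -- recurrence of `z + w`.
  expTerm-+ : ∀ z w k → (expTerm z ⊛ expTerm w) k ≈ expTerm (z + w) k
  expTerm-+ z w = exponential-unique ·1#-invertible {z + w} {expTerm z ⊛ expTerm w} {expTerm (z + w)}
    (exponential-⊛ (expTerm-exponential z) (expTerm-exponential w)) (expTerm-exponential (z + w))

  -- Domination by a real exponential series.

  module Majorant (B : ℕ) where
    β ρ : ℝ.Carrier
    β = ℝ.fromℕ B
    ρ = β ℝ.+ β

    -- ∣re∣ , ∣im∣ ≤ β only bounds the coordinates of a product by 2 β², whence the base 2 β.
    ^-≼ : ∀ {z} → z ≼ β → ∀ k → z ^ k ≼ re (fromℝ ρ ^ k)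
    ^-≼ {z} z≼β zero    = ℝ.0≤x⇒∣x∣≤x 0≤1 , ℝ.∣0∣≤ 0≤1
      where
      0≤1 : ℝ.0# ℝ.≤ ℝ.1#
      0≤1 = ℝ.<⇒≤ ℝ.0<1
    ^-≼ {z} z≼β (suc k) = ℝ.∣∣≤-resp ℝ.refl eq (proj₁ bound) , ℝ.∣∣≤-resp ℝ.refl eq (proj₂ bound)
      where
      bound : z * z ^ k ≼ β ℝ.* re (fromℝ ρ ^ k) ℝ.+ β ℝ.* re (fromℝ ρ ^ k)
      bound = ≼-* {z} {z ^ k} z≼β (^-≼ {z} z≼β k)
      eq : β ℝ.* re (fromℝ ρ ^ k) ℝ.+ β ℝ.* re (fromℝ ρ ^ k) ℝ.≈ re (fromℝ ρ ^ suc k)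
      eq = ℝ.trans (ℝ.sym (ℝ.distribʳ _ _ _)) (ℝ.sym (proj₁ (fromℝ-* ρ (fromℝ ρ ^ k))))

    -- The real series is taken as the real part of the complex one, so that it inherits the Cauchy
    -- property from `expSum-re-cauchy`.
    term : ℕ → ℝ.Carrier
    term k = re (expTerm (fromℝ ρ) k)

    expTerm-≼ : ∀ {z} → z ≼ β → ∀ k → expTerm z k ≼ term k
    expTerm-≼ {z} z≼β k = scale (proj₁ (^-≼ {z} z≼β k)) , scale (proj₂ (^-≼ {z} z≼β k))
      where
      scale : ∀ {x b} → ℝ.∣ x ∣≤ b → ℝ.∣ ℝ.recip (k !) {{k ℕ.!≢0}} ℝ.* x ∣≤ ℝ.recip (k !) {{k ℕ.!≢0}} ℝ.* b
      scale = ℝ.∣*∣≤ (ℝ.0≤x⇒∣x∣≤x (ℝ.<⇒≤ (ℝ.recip-pos (k !) {{k ℕ.!≢0}})))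

    -- A bound on an absolute value is itself nonnegative.
    term-nonNeg : ∀ {z} → z ≼ β → ∀ k → ℝ.0# ℝ.≤ term k
    term-nonNeg {z} z≼β k = ℝ.∣∣≤⇒0≤ (proj₁ (expTerm-≼ {z} z≼β k))

    re-∑ : ∀ n f → re (∑ n f) ≡ ℝ.∑ n (re ∘ f)
    re-∑ zero    f = ≡.refl
    re-∑ (suc n) f = ≡.cong (ℝ._+ re (f n)) (re-∑ n f)

    term-cauchy : ℝ.Cauchy (λ n → ℝ.∑ n term)
    term-cauchy ε 0<ε =
      let N , close = expSum-re-cauchy (fromℝ ρ) ε 0<ε
      in N , λ p q N≤p N≤q → ≡.subst₂ (λ x y → x ℝ.- y ℝ.< ε) (partial p) (partial q) (close p q N≤p N≤q)
      where
      partial : ∀ p → re (expSum (fromℝ ρ) p) ≡ ℝ.∑ p term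
      partial p = ≡.trans (≡.cong re (expSum≡∑ (fromℝ ρ) p)) (re-∑ p (expTerm (fromℝ ρ)))

    null-exp-excess : ∀ {z w} → z ≼ β → w ≼ β → Null (λ n → excess n (expTerm z) (expTerm w))
    null-exp-excess {z} {w} z≼β w≼β =
        ℝ.null-squeeze (λ n → ℝ.∣∣≤-weaken (E≤T n) (proj₁ (E≼ n))) (ℝ.null-+ (proj₁ (proj₂ T)) (proj₁ (proj₂ T)))
      , ℝ.null-squeeze (λ n → ℝ.∣∣≤-weaken (E≤T n) (proj₂ (E≼ n))) (ℝ.null-+ (proj₁ (proj₂ T)) (proj₁ (proj₂ T)))
      where
      T = ℝ.null-excess (term-nonNeg {z} z≼β) term-cauchy
      E≼ : ∀ n → excess n (expTerm z) (expTerm w) ≼ ℝ.excess n term term ℝ.+ ℝ.excess n term term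
      E≼ n = excess-≼ n (expTerm-≼ {z} z≼β) (expTerm-≼ {w} w≼β)
      E≤T : ∀ n → ℝ.excess n term term ℝ.+ ℝ.excess n term term ℝ.≤ proj₁ T n ℝ.+ proj₁ T n
      E≤T n = ℝ.+-mono-≤ (proj₂ (proj₂ T) n) (proj₂ (proj₂ T) n)

  -- The functional equation, the value at 0 and conjugation.

  ∃-common-bound : ∀ z w → ∃[ B ] (z ≼ ℝ.fromℕ B × w ≼ ℝ.fromℕ B)
  ∃-common-bound (x +i y) (u +i v) =
    let a , x◁a = ℝ.∃-bound x
        b , y◁b = ℝ.∃-bound y
        d , u◁d = ℝ.∃-bound u
        e , v◁e = ℝ.∃-bound v
        B = suc ((a ℕ.+ b) ℕ.+ (d ℕ.+ e))
        a≤ = ℕ.≤-trans (ℕ.m≤m+n a b) (ℕ.m≤m+n (a ℕ.+ b) (d ℕ.+ e))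
        b≤ = ℕ.≤-trans (ℕ.m≤n+m b a) (ℕ.m≤m+n (a ℕ.+ b) (d ℕ.+ e))
        d≤ = ℕ.≤-trans (ℕ.m≤m+n d e) (ℕ.m≤n+m (d ℕ.+ e) (a ℕ.+ b))
        e≤ = ℕ.≤-trans (ℕ.m≤n+m e d) (ℕ.m≤n+m (d ℕ.+ e) (a ℕ.+ b))
    in B , (up x◁a a≤ , up y◁b b≤) , (up u◁d d≤ , up v◁e e≤)
    where
    up : ∀ {x a b} → x ℝ.◁ ℝ.fromℕ a → a ℕ.≤ b → ℝ.∣ x ∣≤ ℝ.fromℕ (suc b)
    up x◁a a≤b = ℝ.◁⇒∣∣≤ (ℝ.◁-weaken (ℝ.fromℕ-mono-< (ℕ.s≤s a≤b)) x◁a)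

  -- The product of the partial sums of `z` and `w` exceeds the partial sum of `z + w` by `E p`,
  -- which is null.
  exp-+ : ∀ z w → exp (z + w) ≈ exp z * exp w
  exp-+ z w = exp-unique (z + w) (exp z * exp w) (null-resp
    -- The error of the product of partial sums is split as (s - e) t + (t - f) e, each summand a
    -- null factor times a bounded one; subtracting the excess gives the error for `z + w`.
    {λ p → (D z p * S w p + D w p * exp z) + - excess p (expTerm z) (expTerm w)}
    (λ p → begin
      (D z p * S w p + D w p * exp z) + - E p
        ≈⟨ solve 5 (λ e f s t x → ((s :- e) :* t :+ (t :- f) :* e) :+ (:- x) := (s :* t :+ (:- x)) :- e :* f)
             refl (exp z) (exp w) (S z p) (S w p) (E p) ⟩
      (S z p * S w p + - E p) - exp z * exp w
        ≈⟨ +-congʳ { - (exp z * exp w)} {S z p * S w p + - E p} {S (z + w) p} (begin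
             S z p * S w p + - E p
               ≡⟨ ≡.cong₂ (λ s t → s * t + - E p) (expSum≡∑ z p) (expSum≡∑ w p) ⟩
             ∑ p (expTerm z) * ∑ p (expTerm w) + - E p
               ≈⟨ +-congʳ { - E p} {∑ p (expTerm z) * ∑ p (expTerm w)} {∑ p (expTerm (z + w)) + E p}
                    (trans {∑ p (expTerm z) * ∑ p (expTerm w)} (∑*∑ p (expTerm z) (expTerm w))
                      (+-congʳ {E p} {triangle p (expTerm z) (expTerm w)} {∑ p (expTerm (z + w))}
                        (trans {triangle p (expTerm z) (expTerm w)} (triangle≈∑⊛ p (expTerm z) (expTerm w))
                          (∑-cong p {expTerm z ⊛ expTerm w} {expTerm (z + w)} (λ i _ → expTerm-+ z w i))))) ⟩
             (∑ p (expTerm (z + w)) + E p) + - E p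
               ≈⟨ solve 2 (λ s x → (s :+ x) :+ (:- x) := s) refl (∑ p (expTerm (z + w))) (E p) ⟩
             ∑ p (expTerm (z + w))
               ≡⟨ expSum≡∑ (z + w) p ⟨
             S (z + w) p ∎) ⟩
      S (z + w) p - exp z * exp w ∎)
    (null-+ {λ p → D z p * S w p + D w p * exp z}
      (null-+ {λ p → D z p * S w p} (null-* {D z} (exp-limit z) (expSum-bounded w))
              (null-* {D w} (exp-limit w) (ℝ.bounded-const (re (exp z)) , ℝ.bounded-const (im (exp z)))))
      (null-neg {E} (Majorant.null-exp-excess (proj₁ bound) {z} {w} (proj₁ (proj₂ bound)) (proj₂ (proj₂ bound))))))
    where
    bound = ∃-common-bound z w
    S D : ℂ → ℕ → ℂ
    S = expSum
    D z p = expSum z p - exp z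
    E : ℕ → ℂ
    E p = excess p (expTerm z) (expTerm w)

  exp-0# : exp 0# ≈ 1#
  exp-0# = exp-unique 0# 1# (eventually-zero (λ p → expSum 0# p - 1#) (λ p →
    x≈y⇒x∙y⁻¹≈ε {expSum 0# (suc p)} {1#} (expSum-0# p)))
    where
    expTerm-0# : ∀ k → expTerm 0# (suc k) ≈ 0#
    expTerm-0# k = begin
      expTerm 0# (suc k)                                        ≈⟨ expTerm≈ 0# (suc k) ⟩
      fromℝ (ℝ.recip (suc k !) {{suc k ℕ.!≢0}}) * (0# * 0# ^ k)
        ≈⟨ *-congˡ {fromℝ (ℝ.recip (suc k !) {{suc k ℕ.!≢0}})} {0# * 0# ^ k} {0#} (zeroˡ (0# ^ k)) ⟩
      fromℝ (ℝ.recip (suc k !) {{suc k ℕ.!≢0}}) * 0#            ≈⟨ zeroʳ (fromℝ (ℝ.recip (suc k !) {{suc k ℕ.!≢0}})) ⟩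
      0#                                                        ∎
    expSum-0# : ∀ p → expSum 0# (suc p) ≈ 1#
    expSum-0# zero    = trans {0# + expTerm 0# 0} (+-identityˡ (expTerm 0# 0)) (expTerm-zero 0#)
    expSum-0# (suc p) = trans {expSum 0# (suc p) + expTerm 0# (suc p)} {1# + 0#}
      (+-cong {expSum 0# (suc p)} {1#} {expTerm 0# (suc p)} {0#} (expSum-0# p) (expTerm-0# p)) (+-identityʳ 1#)
    eventually-zero : ∀ s → (∀ p → s (suc p) ≈ 0#) → Null s
    eventually-zero s s≈0 =
        -- The threshold is 1 because the empty partial sum is 0 rather than 1.
        (λ ε 0<ε → 1 , λ { (suc p) _ → ℝ.◁-resp (ℝ.sym (proj₁ (s≈0 p))) ℝ.refl (ℝ.0◁ 0<ε) })
      , (λ ε 0<ε → 1 , λ { (suc p) _ → ℝ.◁-resp (ℝ.sym (proj₂ (s≈0 p))) ℝ.refl (ℝ.0◁ 0<ε) })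

  conj : ℂ → ℂ
  conj z = re z +i ℝ.- im z

  -- The series has real coefficients, so conjugation commutes with the partial sums, and it keeps
  -- null sequences null.
  exp-conj : ∀ z → exp (conj z) ≈ conj (exp z)
  exp-conj z = exp-unique (conj z) (conj (exp z)) (null-resp {λ p → conj (expSum z p - exp z)}
    conj-difference
    (proj₁ (exp-limit z) , ℝ.null-neg (proj₂ (exp-limit z))))
    where
    open ℝ-Solver using () renaming (solve to solveℝ; _:+_ to _⊞_; _:*_ to _⊠_; _:-_ to _⊟_; :-_ to ⊟_; _:=_ to _⊜_)
    open Algebra.Properties.Ring (CommutativeRing.ring ℝ.commutativeRing)
      using (-0#≈0#)
    conj-^ : ∀ k → conj z ^ k ≈ conj (z ^ k)
    conj-^ zero    = ℝ.refl , ℝ.sym -0#≈0#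
    conj-^ (suc k) = trans {conj z * conj z ^ k} {conj z * conj (z ^ k)}
      (*-congˡ {conj z} {conj z ^ k} {conj (z ^ k)} (conj-^ k))
      ( solveℝ 4 (λ a b x y → a ⊠ x ⊟ (⊟ b) ⊠ (⊟ y) ⊜ a ⊠ x ⊟ b ⊠ y) ℝ.refl _ _ _ _
      , solveℝ 4 (λ a b x y → a ⊠ (⊟ y) ⊞ (⊟ b) ⊠ x ⊜ ⊟ (a ⊠ y ⊞ b ⊠ x)) ℝ.refl _ _ _ _)
    conj-expSum : ∀ p → expSum (conj z) p ≈ conj (expSum z p)
    conj-expSum zero    = ℝ.refl , ℝ.sym -0#≈0#
    conj-expSum (suc p) =
        ℝ.+-cong (proj₁ (conj-expSum p)) (ℝ.*-congˡ (proj₁ (conj-^ p)))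
      , ℝ.trans (ℝ.+-cong (proj₂ (conj-expSum p)) (ℝ.*-congˡ (proj₂ (conj-^ p))))
          (solveℝ 3 (λ s r x → (⊟ s) ⊞ r ⊠ (⊟ x) ⊜ ⊟ (s ⊞ r ⊠ x)) ℝ.refl _ _ _)
    conj-difference : ∀ p → conj (expSum z p - exp z) ≈ expSum (conj z) p - conj (exp z)
    conj-difference p =
        ℝ.+-congʳ (ℝ.sym (proj₁ (conj-expSum p)))
      , ℝ.trans (solveℝ 2 (λ s e → ⊟ (s ⊟ e) ⊜ (⊟ s) ⊟ (⊟ e)) ℝ.refl _ _)
          (ℝ.+-congʳ (ℝ.sym (proj₂ (conj-expSum p))))

-- The unit circle and the powers of the root of unity.

module UnitCircle {c ℓ₁ ℓ₂} (R : RealField c ℓ₁ ℓ₂) where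
  private
    module ℝ where
      open RealField R public
      open OrderProperties R public
      open Algebra.Apartness.Properties.HeytingCommutativeRing heytingCommutativeRing public using (x-0≈x)
  open Complex R using (ℂ; _+i_; re; im; exp; sin; IsPi; ζ; Invertible)
  open ComplexRing R using (commutativeRing)
  open CommutativeRing commutativeRing
  open ComplexExponential R using (exp-+; exp-0#; exp-cong; exp-conj; conj)
  open Algebra.Properties.Semiring.Exp semiring using (_^_; ^-congˡ)
  open Algebra.Properties.CommutativeSemiring.Exp commutativeSemiring using (^-distrib-*)
  open IntegerCoefficients commutativeRing using (solve; _:*_; _:-_; _:=_)
  private module ℝ-Solver = IntegerCoefficients ℝ.commutativeRing
  open import Relation.Binary.Reasoning.Setoid setoid

  cis : ℝ.Carrier → ℂ
  cis x = exp (ℝ.0# +i x)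

  cis-cong : ∀ {x y} → x ℝ.≈ y → cis x ≈ cis y
  cis-cong {x} {y} x≈y = exp-cong {ℝ.0# +i x} {ℝ.0# +i y} (ℝ.refl , x≈y)

  cis-0# : cis ℝ.0# ≈ 1#
  cis-0# = exp-0#

  cis-+ : ∀ x y → cis (x ℝ.+ y) ≈ cis x * cis y
  cis-+ x y = trans {cis (x ℝ.+ y)} {exp ((ℝ.0# +i x) + (ℝ.0# +i y))} {cis x * cis y}
    (exp-cong {ℝ.0# +i x ℝ.+ y} {(ℝ.0# +i x) + (ℝ.0# +i y)} (ℝ.sym (ℝ.+-identityʳ ℝ.0#) , ℝ.refl))
    (exp-+ (ℝ.0# +i x) (ℝ.0# +i y))

  cis-^ : ∀ x k → cis x ^ k ≈ cis (ℝ.fromℕ k ℝ.* x)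
  cis-^ x zero    = begin
    1#                    ≈⟨ cis-0# ⟨
    cis ℝ.0#              ≈⟨ cis-cong (ℝ.zeroˡ x) ⟨
    cis (ℝ.0# ℝ.* x)      ∎
  cis-^ x (suc k) = begin
    cis x * cis x ^ k                ≈⟨ *-congˡ {cis x} {cis x ^ k} {cis (ℝ.fromℕ k ℝ.* x)} (cis-^ x k) ⟩
    cis x * cis (ℝ.fromℕ k ℝ.* x)    ≈⟨ cis-+ x (ℝ.fromℕ k ℝ.* x) ⟨
    cis (x ℝ.+ ℝ.fromℕ k ℝ.* x)
      ≈⟨ cis-cong (ℝ.trans (ℝ.distribʳ _ _ _) (ℝ.+-congʳ (ℝ.*-identityˡ x))) ⟨
    cis (ℝ.fromℕ (suc k) ℝ.* x)      ∎

  -- Conjugation negates a purely imaginary argument, so the exponents cancel; no identity between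
  -- sine and cosine is involved.
  cis-*-conj : ∀ x → cis x * conj (cis x) ≈ 1#
  cis-*-conj x = begin
    cis x * conj (cis x)    ≈⟨ *-congˡ {cis x} {cis (ℝ.- x)} {conj (cis x)} (exp-conj (ℝ.0# +i x)) ⟨
    cis x * cis (ℝ.- x)     ≈⟨ cis-+ x (ℝ.- x) ⟨
    cis (x ℝ.- x)           ≈⟨ cis-cong (ℝ.-‿inverseʳ x) ⟩
    cis ℝ.0#                ≈⟨ cis-0# ⟩
    1#                      ∎

  sin≈0⇒cis²≈1 : ∀ {x} → sin x ℝ.≈ ℝ.0# → cis x * cis x ≈ 1#
  sin≈0⇒cis²≈1 {x} sin≈0 = trans {cis x * cis x} {cis x * conj (cis x)}
    (*-congˡ {cis x} {cis x} {conj (cis x)}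
      (ℝ.refl , ℝ.trans sin≈0 (ℝ.sym (ℝ.trans (ℝ.-‿cong sin≈0) -0#≈0#))))
    (cis-*-conj x)
    where open Algebra.Properties.Ring (CommutativeRing.ring ℝ.commutativeRing) using (-0#≈0#)

  invertible-resp : ∀ {z w} → z ≈ w → Invertible z → Invertible w
  invertible-resp {z} {w} z≈w (u , uz≈1 , zu≈1) =
      u , trans {u * w} {u * z} (*-congˡ {u} {w} {z} (sym {z} {w} z≈w)) uz≈1
        , trans {w * u} {z * u} (*-congʳ {u} {w} {z} (sym {z} {w} z≈w)) zu≈1

  invertibleʳ : ∀ z u → z * u ≈ 1# → Invertible z
  invertibleʳ z u zu≈1 = u , trans {u * z} {z * u} (*-comm u z) zu≈1 , zu≈1

  -- 1 - c² = c (c̄ - c) for c on the unit circle, and c̄ - c is - 2 i times the sine.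
  1-cis²-invertible : ∀ x → sin x ℝ.# ℝ.0# → Invertible (1# - cis x * cis x)
  1-cis²-invertible x sin#0 = invertibleʳ (1# - e * e) (conj e * (ℝ.0# +i u)) (begin
    (1# - e * e) * (conj e * v)
      ≈⟨ *-congʳ {conj e * v} {1# - e * e} {e * conj e - e * e}
           (+-congʳ { - (e * e)} {1#} {e * conj e} (sym {e * conj e} {1#} (cis-*-conj x))) ⟩
    (e * conj e - e * e) * (conj e * v)
      ≈⟨ solve 3 (λ e e′ v → (e :* e′ :- e :* e) :* (e′ :* v) := (e :* e′) :* ((e′ :- e) :* v)) refl e (conj e) v ⟩
    e * conj e * ((conj e - e) * v)
      ≈⟨ *-cong {e * conj e} {1#} {(conj e - e) * v} {1#} (cis-*-conj x) imaginary ⟩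
    1# * 1#
      ≈⟨ *-identityˡ 1# ⟩
    1# ∎)
    where
    open ℝ-Solver using () renaming (solve to solveℝ; _:+_ to _⊞_; _:*_ to _⊠_; _:-_ to _⊟_; :-_ to ⊟_; _:=_ to _⊜_)
    s s⁻¹ u : ℝ.Carrier
    s = sin x
    s⁻¹ = proj₁ (ℝ.#⇒invertible sin#0)
    -- As `conj e - e` is - 2 i s, its inverse is i / (2 s), that is, i u. The factor `conj e` in
    -- the full inverse cancels the remaining `e`.
    u = ℝ.recip 2 ℝ.* s⁻¹
    e v : ℂ
    e = cis x
    v = ℝ.0# +i u
    s*s⁻¹ : s ℝ.* s⁻¹ ℝ.≈ ℝ.1#
    s*s⁻¹ = ℝ.trans (ℝ.*-congʳ (ℝ.sym (ℝ.x-0≈x s))) (proj₂ (proj₂ (ℝ.#⇒invertible sin#0)))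
    2su≈1 : (s ℝ.+ s) ℝ.* u ℝ.≈ ℝ.1#
    2su≈1 = ℝ.trans (ℝ.*-congʳ (ℝ.sym (ℝ.trans (ℝ.distribʳ s ℝ.1# ℝ.1#) (ℝ.+-cong (ℝ.*-identityˡ s) (ℝ.*-identityˡ s)))))
      (ℝ.trans (solveℝ 4 (λ t s r s′ → (t ⊠ s) ⊠ (r ⊠ s′) ⊜ (t ⊠ r) ⊠ (s ⊠ s′)) ℝ.refl (ℝ.1# ℝ.+ ℝ.1#) s (ℝ.recip 2) s⁻¹)
        (ℝ.trans (ℝ.*-cong
          (ℝ.trans (ℝ.*-congʳ (ℝ.+-congˡ (ℝ.sym (ℝ.+-identityʳ ℝ.1#)))) (ℝ.recip-inverse 2))
          s*s⁻¹) (ℝ.*-identityˡ ℝ.1#)))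
    imaginary : (conj e - e) * v ≈ 1#
    imaginary =
        ℝ.trans (ℝ.+-congʳ (ℝ.zeroʳ _))
          (ℝ.trans (ℝ.+-identityˡ _)
            (ℝ.trans (solveℝ 2 (λ s u → ⊟ (((⊟ s) ⊟ s) ⊠ u) ⊜ (s ⊞ s) ⊠ u) ℝ.refl s u) 2su≈1))
      , ℝ.trans (ℝ.+-cong (ℝ.trans (ℝ.*-congʳ (ℝ.-‿inverseʳ _)) (ℝ.zeroˡ _)) (ℝ.zeroʳ _)) (ℝ.+-identityʳ ℝ.0#)

  module _ {π} (isPi : IsPi π) (n : ℕ) .{{_ : NonZero n}} where

    -- Halving the angle 2 π / n makes every power a square of `cis` at k π / n. For 0 < k < n this
    -- angle lies between 0 and π, where `IsPi` controls the sine; for k = n it is π.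
    ζ-^ : ∀ k → ζ π n ^ k ≈ cis (ℝ._÷_ k n ℝ.* π) * cis (ℝ._÷_ k n ℝ.* π)
    ζ-^ k = begin
      ζ π n ^ k
        ≈⟨ ^-congˡ k {ζ π n} {cis δ * cis δ} (trans {ζ π n} {cis (δ ℝ.+ δ)} (cis-cong 2π/n) (cis-+ δ δ)) ⟩
      (cis δ * cis δ) ^ k                ≈⟨ ^-distrib-* (cis δ) (cis δ) k ⟩
      cis δ ^ k * cis δ ^ k              ≈⟨ *-cong {cis δ ^ k} {cis y} {cis δ ^ k} {cis y} cis-δ^k cis-δ^k ⟩
      cis y * cis y                      ∎
      where
      δ y : ℝ.Carrier
      δ = π ℝ.* ℝ.recip n
      y = ℝ._÷_ k n ℝ.* π
      cis-δ^k : cis δ ^ k ≈ cis y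
      cis-δ^k = trans {cis δ ^ k} {cis (ℝ.fromℕ k ℝ.* δ)} (cis-^ δ k)
        (cis-cong (ℝ.trans (ℝ.*-congˡ (ℝ.*-comm π (ℝ.recip n))) (ℝ.sym (ℝ.*-assoc _ _ _))))
      2π/n : (ℝ.1# ℝ.+ ℝ.1#) ℝ.* π ℝ.* ℝ.recip n ℝ.≈ δ ℝ.+ δ
      2π/n = ℝ.trans
        (ℝ.*-congʳ (ℝ.trans (ℝ.distribʳ _ _ _) (ℝ.+-cong (ℝ.*-identityˡ π) (ℝ.*-identityˡ π))))
        (ℝ.distribʳ _ _ _)

    ζ-^-n : ζ π n ^ n ≈ 1#
    ζ-^-n = begin
      ζ π n ^ n                ≈⟨ ζ-^ n ⟩
      cis y * cis y            ≈⟨ *-cong {cis y} {cis π} {cis y} {cis π} (cis-cong y≈π) (cis-cong y≈π) ⟩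
      cis π * cis π            ≈⟨ sin≈0⇒cis²≈1 (proj₁ (proj₂ isPi)) ⟩
      1#                       ∎
      where
      y : ℝ.Carrier
      y = ℝ._÷_ n n ℝ.* π
      y≈π : y ℝ.≈ π
      y≈π = ℝ.trans (ℝ.*-congʳ (ℝ.recip-inverse n)) (ℝ.*-identityˡ π)

    1-ζ^-invertible : ∀ j → suc j ℕ.< n → Invertible (1# - ζ π n ^ suc j)
    1-ζ^-invertible j j<n = invertible-resp {1# - cis y * cis y} {1# - ζ π n ^ suc j}
      (+-congˡ {1#} { - (cis y * cis y)} { - (ζ π n ^ suc j)}
        (-‿cong {cis y * cis y} {ζ π n ^ suc j} (sym {ζ π n ^ suc j} (ζ-^ (suc j)))))
      (1-cis²-invertible y (proj₂ (proj₂ isPi) y 0<y y<π))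
      where
      y : ℝ.Carrier
      y = ℝ._÷_ (suc j) n ℝ.* π
      0<y : ℝ.0# ℝ.< y
      0<y = ℝ.*-pos (ℝ.*-pos (ℝ.fromℕ-pos j) (ℝ.recip-pos n)) (proj₁ isPi)
      y<π : y ℝ.< π
      y<π = ℝ.<-respˡ (ℝ.*-comm _ _)
        (ℝ.<-respʳ (ℝ.trans (ℝ.*-congˡ (ℝ.recip-inverse n)) (ℝ.*-identityʳ π))
          (ℝ.*-monoˡ-< (proj₁ isPi)
            (ℝ.<-respˡ (ℝ.*-comm _ _) (ℝ.<-respʳ (ℝ.*-comm _ _)
              (ℝ.*-monoˡ-< (ℝ.recip-pos n) (ℝ.fromℕ-mono-< j<n))))))

-- The two cases of the theorem.

open import Data.Nat.Base using (_≤_; _<_)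

corollary1p4 : ∀ {c ℓ₁ ℓ₂} (R : RealField c ℓ₁ ℓ₂) →
    let open Complex R in
    ∀ π → IsPi π →
    ∀ k n m → .{{_ : NonZero k}} → .{{_ : NonZero n}} →
    m ≤ k → k < n →
    let ζₙ = ζ π n in
    (k ≤ n ∸ 2 →
    Σ[ 1-ζʲ≢0 ∈ (∀ (j : Fin (n ∸ k ∸ 1)) → Invertible (1# - ζₙ ^ suc (toℕ j))) ]
    𝓔 m (applyUpTo (ζₙ ^_) k)
    ≈ (- 1#) ^ m * ζₙ ^ (m ℕ.* k)
    * product (λ j → (1# - ζₙ ^ (m ℕ.+ suc (toℕ j))) * 1-ζʲ≢0 j ⁻¹))
    ×
    (k ≡ n ∸ 1 →
    Σ[ ζ≢0 ∈ Invertible ζₙ ]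
    𝓔 m (applyUpTo (ζₙ ^_) k) ≈ (- 1#) ^ m * (ζ≢0 ⁻¹) ^ m)
corollary1p4 R π isPi k n m m≤k k<n = generic , boundary
  where
  open Complex R using (ℂ; ζ; 𝓔; Invertible; product; _⁻¹)
  open CommutativeRing (ComplexRing.commutativeRing R)
  open Algebra.Properties.Semiring.Exp semiring using (_^_; ^-assocʳ; ^-congʳ)
  open ElementarySymmetric R using (𝓔-zero; 𝓔-geometric)
  open UnitCircle R using (ζ-^-n; 1-ζ^-invertible; invertibleʳ)
  open import Relation.Binary.Reasoning.Setoid setoid

  ζₙ : ℂ
  ζₙ = ζ π n

  E : ℕ → ℕ → ℂ
  E k m = 𝓔 m (applyUpTo (ζₙ ^_) k)

  -- Common source of both cases: the general formula at `ζₙ` with d = n - k - 1 factors.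
  closed : ∀ d → k ℕ.+ suc d ≡ n → (inv : ∀ (j : Fin d) → Invertible (1# - ζₙ ^ suc (toℕ j))) →
           E k m ≈ (- 1#) ^ m * ζₙ ^ (m ℕ.* k)
                   * product (λ j → (1# - ζₙ ^ (m ℕ.+ suc (toℕ j))) * inv j ⁻¹)
  closed d k+1+d≡n inv = GaussianPascal.E-closed (ComplexRing.commutativeRing R) ζₙ E
    (λ k → 𝓔-zero (applyUpTo (ζₙ ^_) k)) (λ m → refl {0#}) (𝓔-geometric ζₙ)
    n (ζ-^-n isPi n) (1-ζ^-invertible isPi n) k d k+1+d≡n inv m m≤k

  generic : k ≤ n ∸ 2 → _
  generic _ = inv , closed d k+1+d≡n inv
    where
    d : ℕ
    d = n ∸ k ∸ 1
    k+1+d≡n : k ℕ.+ suc d ≡ n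
    k+1+d≡n = ≡.trans (≡.cong (k ℕ.+_) (ℕ.m+[n∸m]≡n (ℕ.m<n⇒0<n∸m k<n))) (ℕ.m+[n∸m]≡n (ℕ.<⇒≤ k<n))
    inv : ∀ (j : Fin d) → Invertible (1# - ζₙ ^ suc (toℕ j))
    -- The exponents of the denominators are at most d, and d < k + (d + 1) = n.
    inv j = 1-ζ^-invertible isPi n (toℕ j) (ℕ.≤-trans (ℕ.s≤s (Fin.toℕ<n j))
      (ℕ.≤-trans (ℕ.m≤n+m (suc d) k) (ℕ.≤-reflexive k+1+d≡n)))

  boundary : k ≡ n ∸ 1 → _
  -- Since k + 1 = n, the power ζₙ ^ k is the inverse of `ζₙ`, and ζₙ ^ (m k) is its m-th power.
  boundary k≡n-1 = invertibleʳ ζₙ (ζₙ ^ k) (trans {ζₙ ^ suc k} {ζₙ ^ n} (^-congʳ ζₙ 1+k≡n) (ζ-^-n isPi n)) ,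
    (begin
      -- With d = 0 the product is empty and equals 1.
      E k m                                  ≈⟨ closed 0 (≡.trans (ℕ.+-comm k 1) 1+k≡n) (λ ()) ⟩
      (- 1#) ^ m * ζₙ ^ (m ℕ.* k) * 1#       ≈⟨ *-identityʳ ((- 1#) ^ m * ζₙ ^ (m ℕ.* k)) ⟩
      (- 1#) ^ m * ζₙ ^ (m ℕ.* k)            ≈⟨ *-congˡ {(- 1#) ^ m} {ζₙ ^ (m ℕ.* k)} {(ζₙ ^ k) ^ m}
                                                  (trans {ζₙ ^ (m ℕ.* k)} {ζₙ ^ (k ℕ.* m)} (^-congʳ ζₙ (ℕ.*-comm m k))
                                                    (sym {(ζₙ ^ k) ^ m} (^-assocʳ ζₙ k m))) ⟩
      (- 1#) ^ m * (ζₙ ^ k) ^ m              ∎)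
    where
    1+k≡n : suc k ≡ n
    -- From k < n it follows that 1 ≤ n, so `n ∸ 1` is not truncated.
    1+k≡n = ≡.trans (≡.cong suc k≡n-1) (ℕ.m+[n∸m]≡n (ℕ.≤-trans (ℕ.s≤s ℕ.z≤n) k<n))
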